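{- Let $k \geq 2$ be an even integer. Let $q$ be a prime power such that $q \equiv k+1 \pmod{2k}$. Then $$\mathcal{K}_3(G_k(q)) = \frac{q(q-1)}{k^3} \, ( \mathbb{R}_k(q) + q -2k+1),$$ where $$\mathbb{R}_k(q) := \sum_{\substack{s,t=1 \\ s+t \not\equiv 0 \, (k)}}^{k-1} J(\chi_k^s, \chi_k^t).$$
   Context: $\mathbb{F}_q$ is the finite field with $q$ elements and $S_k \subset \mathbb{F}_q^*$ is the subgroup of nonzero $k$-th powers (of order $\frac{q-1}{k}$). The $k$-th power Paley digraph $G_k(q)$ has vertex set $\mathbb{F}_q$, and $a \to b$ is an edge if and only if $b-a \in S_k$ (the condition on $q$ gives $-1 \notin S_k$, so there is at most one edge between any two vertices). For a digraph $G$, $\mathcal{K}_m(G)$ is the number of transitive subtournaments of order $m$ contained in $G$; a tournament of order $m$ is transitive if its vertices can be listed $a_1,\dots,a_m$ with $a_i \to a_j$ for all $i<j$. $\chi_k$ is a fixed (complex-valued) multiplicative character of $\mathbb{F}_q^*$ of order $k$. Multiplicative characters $\chi$ (including the trivial one) are extended to $\mathbb{F}_q$ by $\chi(0):=0$, and for characters $A,B$ the Jacobi sum is $J(A,B):=\sum_{a \in \mathbb{F}_q} A(a)B(1-a)$. -}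

module Defs where

open import Level using (Level; 0ℓ; _⊔_) renaming (suc to lsuc)
open import Algebra.Bundles using (RawMonoid; CommutativeRing)
open import Algebra.Morphism.Bundles using (MonoidHomomorphism)
import Algebra.Definitions.RawMonoid as RawMonoidDefinitions
import Algebra.Properties.CommutativeSemiring.Exp as Exp
open import Data.Fin.Base using (Fin)
import Data.Fin.Properties as Fin
open import Data.Fin.Subset using (Subset; inside; outside; ∣_∣; _∈_)
open import Data.Fin.Subset.Properties using (_∈?_)
open import Data.Integer.Base using (ℤ; +_)
import Data.Integer.Base as ℤ
import Data.Integer.Divisibility as ℤ∣
open import Data.List.Base using (List; []; _∷_; _++_; map; filter; foldr; length; applyUpTo; cartesianProduct)
open import Data.Nat.Base as ℕ using (ℕ; zero; suc)
import Data.Nat.Properties as ℕ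
open import Data.Nat.Divisibility using (_∣?_)
open import Data.Nat.Primality using (Prime)
open import Data.Product.Base using (∃-syntax; Σ; _×_; _,_; proj₁; proj₂)
open import Data.Rational.Base as ℚ using (ℚ; 0ℚ; 1ℚ; ½)
import Data.Rational.Properties as ℚ
open import Data.Rational.Solver using (module +-*-Solver)
open import Data.Sum.Base using (_⊎_)
open import Data.Vec.Base using (Vec; []; _∷_)
import Data.Vec.Membership.Propositional as Vec
open import Data.Vec.Relation.Unary.AllPairs using (AllPairs; allPairs?)
open import Data.Vec.Relation.Unary.Any using () renaming (any? to anyEntry?)
open import Function.Bundles using (Inverse)
open import Relation.Binary.Core using (Rel)
open import Relation.Binary.Definitions using (Irreflexive; Decidable)
open import Relation.Binary.PropositionalEquality as ≡ using (_≡_; _≢_)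
open import Relation.Nullary.Decidable using (Dec; yes; no; map′; ¬?; _×-dec_; _⊎-dec_; _→-dec_)
open import Relation.Nullary.Negation using (¬_)
import Relation.Unary as U

infix 4 _≡_[mod_]

_≡_[mod_] : ℕ → ℕ → ℕ → Set
a ≡ b [mod n ] = + n ℤ∣.∣ (+ a ℤ.- + b)

IsPrimePower : ℕ → Set
IsPrimePower q = ∃[ p ] ∃[ n ] (Prime p × 1 ℕ.≤ n × q ≡ p ℕ.^ n)

-- Reals are Cauchy sequences of rationals, compared by an explicit
-- equivalence relation in place of a quotient.
record ℝ : Set where
  field
    seq    : ℕ → ℚ
    cauchy : ∀ ε → 0ℚ ℚ.< ε →
             ∃[ N ] (∀ m n → N ℕ.≤ m → N ℕ.≤ n → ℚ.∣ seq m ℚ.- seq n ∣ ℚ.< ε)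

open ℝ public

infix 4 _≈ℝ_

_≈ℝ_ : Rel ℝ 0ℓ
x ≈ℝ y = ∀ ε → 0ℚ ℚ.< ε →
         ∃[ N ] (∀ n → N ℕ.≤ n → ℚ.∣ seq x n ℚ.- seq y n ∣ ℚ.< ε)

≤-maxˡ : ∀ {a b n} → a ℕ.⊔ b ℕ.≤ n → a ℕ.≤ n
≤-maxˡ {a} {b} = ℕ.≤-trans (ℕ.m≤m⊔n a b)

≤-maxʳ : ∀ {a b n} → a ℕ.⊔ b ℕ.≤ n → b ℕ.≤ n
≤-maxʳ {a} {b} = ℕ.≤-trans (ℕ.m≤n⊔m a b)

half>0 : ∀ {ε} → 0ℚ ℚ.< ε → 0ℚ ℚ.< ½ ℚ.* ε
half>0 {ε} ε>0 = ℚ.positive⁻¹ (½ ℚ.* ε) {{ℚ.pos*pos⇒pos ½ ε {{ℚ.positive ε>0}}}}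

halves : ∀ ε → ½ ℚ.* ε ℚ.+ ½ ℚ.* ε ≡ ε
halves ε = ≡.trans (≡.sym (ℚ.*-distribʳ-+ ε ½ ½)) (ℚ.*-identityˡ ε)

<-halves : ∀ {p q ε} → p ℚ.< ½ ℚ.* ε → q ℚ.< ½ ℚ.* ε → p ℚ.+ q ℚ.< ε
<-halves {p} {q} {ε} p< q< = ≡.subst (_ ℚ.<_) (halves ε) (ℚ.+-mono-< {p} {½ ℚ.* ε} {q} {½ ℚ.* ε} p< q<)

∣x-x∣≡0 : ∀ p → ℚ.∣ p ℚ.- p ∣ ≡ 0ℚ
∣x-x∣≡0 p = ≡.cong ℚ.∣_∣ (ℚ.+-inverseʳ p)

∣-∣-swap : ∀ p q → ℚ.∣ p ℚ.- q ∣ ≡ ℚ.∣ q ℚ.- p ∣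
∣-∣-swap p q = ≡.trans (≡.cong ℚ.∣_∣ (solve 2 (λ a b → a :- b := :- (b :- a)) ≡.refl p q))
                       (ℚ.∣-p∣≡∣p∣ (q ℚ.- p))
  where open +-*-Solver

triangle : ∀ p q r → ℚ.∣ p ℚ.- r ∣ ℚ.≤ ℚ.∣ p ℚ.- q ∣ ℚ.+ ℚ.∣ q ℚ.- r ∣
triangle p q r = ≡.subst (ℚ._≤ ℚ.∣ p ℚ.- q ∣ ℚ.+ ℚ.∣ q ℚ.- r ∣)
  (≡.cong ℚ.∣_∣ (solve 3 (λ a b c → (a :- b) :+ (b :- c) := a :- c) ≡.refl p q r))
  (ℚ.∣p+q∣≤∣p∣+∣q∣ (p ℚ.- q) (q ℚ.- r))
  where open +-*-Solver

+-close : ∀ a b c d {ε} → ℚ.∣ a ℚ.- c ∣ ℚ.< ½ ℚ.* ε → ℚ.∣ b ℚ.- d ∣ ℚ.< ½ ℚ.* ε →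
          ℚ.∣ (a ℚ.+ b) ℚ.- (c ℚ.+ d) ∣ ℚ.< ε
+-close a b c d p q = ℚ.≤-<-trans
  (≡.subst (ℚ._≤ ℚ.∣ a ℚ.- c ∣ ℚ.+ ℚ.∣ b ℚ.- d ∣)
    (≡.cong ℚ.∣_∣ (solve 4 (λ a b c d → (a :- c) :+ (b :- d) := (a :+ b) :- (c :+ d)) ≡.refl a b c d))
    (ℚ.∣p+q∣≤∣p∣+∣q∣ (a ℚ.- c) (b ℚ.- d)))
  (<-halves p q)
  where open +-*-Solver

*-bound : ∀ u v {B δ} → 0ℚ ℚ.< B → ℚ.∣ u ∣ ℚ.< B → ℚ.∣ v ∣ ℚ.< δ → ℚ.∣ u ℚ.* v ∣ ℚ.< B ℚ.* δ
*-bound u v {B} {δ} B>0 u<B v<δ = ≡.subst (ℚ._< B ℚ.* δ) (≡.sym (ℚ.∣p*q∣≡∣p∣*∣q∣ u v))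
  (ℚ.≤-<-trans
    (ℚ.*-monoʳ-≤-nonNeg ℚ.∣ v ∣ {{ℚ.∣-∣-nonNeg v}} (ℚ.<⇒≤ u<B))
    (ℚ.*-monoʳ-<-pos B {{ℚ.positive B>0}} v<δ))

*-close : ∀ a b c d {B δ ε} → 0ℚ ℚ.< B → B ℚ.* δ ≡ ½ ℚ.* ε →
          ℚ.∣ a ∣ ℚ.< B → ℚ.∣ d ∣ ℚ.< B →
          ℚ.∣ a ℚ.- c ∣ ℚ.< δ → ℚ.∣ b ℚ.- d ∣ ℚ.< δ →
          ℚ.∣ a ℚ.* b ℚ.- c ℚ.* d ∣ ℚ.< ε
*-close a b c d B>0 Bδ a<B d<B ac bd = ℚ.≤-<-trans
  (≡.subst (ℚ._≤ ℚ.∣ a ℚ.* (b ℚ.- d) ∣ ℚ.+ ℚ.∣ d ℚ.* (a ℚ.- c) ∣)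
    (≡.cong ℚ.∣_∣ (solve 4 (λ a b c d → a :* (b :- d) :+ d :* (a :- c) := a :* b :- c :* d) ≡.refl a b c d))
    (ℚ.∣p+q∣≤∣p∣+∣q∣ (a ℚ.* (b ℚ.- d)) (d ℚ.* (a ℚ.- c))))
  (<-halves
    (≡.subst (_ ℚ.<_) Bδ (*-bound a (b ℚ.- d) B>0 a<B bd))
    (≡.subst (_ ℚ.<_) Bδ (*-bound d (a ℚ.- c) B>0 d<B ac)))
  where open +-*-Solver

0<1 : 0ℚ ℚ.< 1ℚ
0<1 = ℚ.positive⁻¹ 1ℚ

bounded : (x : ℝ) → ∃[ B ] ∃[ N ] (0ℚ ℚ.< B × (∀ n → N ℕ.≤ n → ℚ.∣ seq x n ∣ ℚ.< B))
bounded x with cauchy x 1ℚ 0<1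
... | N , close = B , N , B>0 , below
  where
  a = seq x N
  B = 1ℚ ℚ.+ ℚ.∣ a ∣
  B>0 : 0ℚ ℚ.< B
  B>0 = ℚ.+-mono-<-≤ {0ℚ} {1ℚ} {0ℚ} {ℚ.∣ a ∣} 0<1 (ℚ.0≤∣p∣ a)
  below : ∀ n → N ℕ.≤ n → ℚ.∣ seq x n ∣ ℚ.< B
  below n N≤n = ℚ.≤-<-trans
    (≡.subst (λ p → ℚ.∣ p ∣ ℚ.≤ ℚ.∣ seq x n ℚ.- a ∣ ℚ.+ ℚ.∣ a ∣)
      (solve 2 (λ u v → (u :- v) :+ v := u) ≡.refl (seq x n) a)
      (ℚ.∣p+q∣≤∣p∣+∣q∣ (seq x n ℚ.- a) a))
    (ℚ.+-mono-<-≤ {ℚ.∣ seq x n ℚ.- a ∣} {1ℚ} {ℚ.∣ a ∣} {ℚ.∣ a ∣}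
      (close n N N≤n ℕ.≤-refl) ℚ.≤-refl)
    where open +-*-Solver

sum>0 : ∀ {B C} → 0ℚ ℚ.< B → 0ℚ ℚ.< C → 0ℚ ℚ.< B ℚ.+ C
sum>0 {B} {C} B>0 C>0 = ℚ.+-mono-< {0ℚ} {B} {0ℚ} {C} B>0 C>0

<-+ʳ : ∀ {B C} → 0ℚ ℚ.< C → B ℚ.< B ℚ.+ C

<-+ʳ {B} {C} C>0 = ≡.subst (ℚ._< B ℚ.+ C) (ℚ.+-identityʳ B) (ℚ.+-mono-≤-< {B} {B} {0ℚ} {C} ℚ.≤-refl C>0)

<-+ˡ : ∀ {B C} → 0ℚ ℚ.< B → C ℚ.< B ℚ.+ C

<-+ˡ {B} {C} B>0 = ≡.subst (ℚ._< B ℚ.+ C) (ℚ.+-identityˡ C) (ℚ.+-mono-<-≤ {0ℚ} {B} {C} {C} B>0 ℚ.≤-refl)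

bounded₂ : (x y : ℝ) → ∃[ B ] ∃[ N ] (0ℚ ℚ.< B ×
           (∀ n → N ℕ.≤ n → ℚ.∣ seq x n ∣ ℚ.< B × ℚ.∣ seq y n ∣ ℚ.< B))
bounded₂ x y =
  let B , M , B>0 , xB = bounded x
      C , N , C>0 , yC = bounded y
  in B ℚ.+ C , M ℕ.⊔ N , sum>0 {B} {C} B>0 C>0 , λ n le →
      ℚ.<-trans {ℚ.∣ seq x n ∣} {B} {B ℚ.+ C} (xB n (≤-maxˡ le)) (<-+ʳ {B} {C} C>0)
    , ℚ.<-trans {ℚ.∣ seq y n ∣} {C} {B ℚ.+ C} (yC n (≤-maxʳ {M} le)) (<-+ˡ {B} {C} B>0)

shrink : ∀ {B ε} → 0ℚ ℚ.< B → 0ℚ ℚ.< ε → ∃[ δ ] (0ℚ ℚ.< δ × B ℚ.* δ ≡ ½ ℚ.* ε)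
shrink {B} {ε} B>0 ε>0 = δ , δ>0 , Bδ
  where
  instance
    B-pos : ℚ.Positive B
    B-pos = ℚ.positive B>0
    B-nz : ℚ.NonZero B
    B-nz = ℚ.pos⇒nonZero B
  δ = ℚ.1/ B ℚ.* (½ ℚ.* ε)
  δ>0 : 0ℚ ℚ.< δ
  δ>0 = ℚ.positive⁻¹ δ {{ℚ.pos*pos⇒pos (ℚ.1/ B) {{ℚ.1/pos⇒pos B}} (½ ℚ.* ε) {{ℚ.positive (half>0 ε>0)}}}}
  Bδ : B ℚ.* δ ≡ ½ ℚ.* ε
  Bδ = ≡.trans (≡.sym (ℚ.*-assoc B (ℚ.1/ B) (½ ℚ.* ε)))
       (≡.trans (≡.cong (ℚ._* (½ ℚ.* ε)) (ℚ.*-inverseʳ B)) (ℚ.*-identityˡ (½ ℚ.* ε)))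

infixl 6 _+ℝ_
infixl 7 _*ℝ_
infix  8 -ℝ_

fromℚ : ℚ → ℝ
fromℚ p = record
  { seq    = λ _ → p
  ; cauchy = λ ε ε>0 → 0 , λ _ _ _ _ → ≡.subst (ℚ._< ε) (≡.sym (∣x-x∣≡0 p)) ε>0
  }

_+ℝ_ : ℝ → ℝ → ℝ
x +ℝ y = record
  { seq    = λ n → seq x n ℚ.+ seq y n
  ; cauchy = λ ε ε>0 →
      let M , p = cauchy x (½ ℚ.* ε) (half>0 ε>0)
          N , q = cauchy y (½ ℚ.* ε) (half>0 ε>0)
      in M ℕ.⊔ N , λ m n le le′ →
           +-close (seq x m) (seq y m) (seq x n) (seq y n)
             (p m n (≤-maxˡ le) (≤-maxˡ le′)) (q m n (≤-maxʳ {M} le) (≤-maxʳ {M} le′))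
  }

-ℝ_ : ℝ → ℝ
-ℝ x = record
  { seq    = λ n → ℚ.- seq x n
  ; cauchy = λ ε ε>0 →
      let N , p = cauchy x ε ε>0
      in N , λ m n le le′ → ≡.subst (ℚ._< ε) (neg (seq x n) (seq x m)) (p n m le′ le)
  }
  where
  neg : ∀ a b → ℚ.∣ a ℚ.- b ∣ ≡ ℚ.∣ ℚ.- b ℚ.- ℚ.- a ∣
  neg a b = ≡.cong ℚ.∣_∣ (solve 2 (λ a b → a :- b := :- b :- (:- a)) ≡.refl a b)
    where open +-*-Solver

_*ℝ_ : ℝ → ℝ → ℝ
x *ℝ y = record
  { seq    = λ n → seq x n ℚ.* seq y n
  ; cauchy = λ ε ε>0 →
      let B , K , B>0 , bnd = bounded₂ x y
          δ , δ>0 , Bδ = shrink B>0 ε>0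
          M , p = cauchy x δ δ>0
          N , q = cauchy y δ δ>0
      in K ℕ.⊔ (M ℕ.⊔ N) , λ m n le le′ →
           *-close (seq x m) (seq y m) (seq x n) (seq y n) B>0 Bδ
             (proj₁ (bnd m (≤-maxˡ le))) (proj₂ (bnd n (≤-maxˡ le′)))
             (p m n (≤-maxˡ (≤-maxʳ {K} le)) (≤-maxˡ (≤-maxʳ {K} le′)))
             (q m n (≤-maxʳ {M} (≤-maxʳ {K} le)) (≤-maxʳ {M} (≤-maxʳ {K} le′)))
  }

≈ℝ-pointwise : ∀ {x y} → (∀ n → seq x n ≡ seq y n) → x ≈ℝ y
≈ℝ-pointwise {x} {y} eq ε ε>0 = 0 , λ n _ →
  ≡.subst (ℚ._< ε)
    (≡.trans (≡.sym (∣x-x∣≡0 (seq y n))) (≡.cong (λ p → ℚ.∣ p ℚ.- seq y n ∣) (≡.sym (eq n)))) ε>0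

≈ℝ-refl : ∀ {x} → x ≈ℝ x
≈ℝ-refl {x} = ≈ℝ-pointwise {x} {x} (λ _ → ≡.refl)

≈ℝ-sym : ∀ {x y} → x ≈ℝ y → y ≈ℝ x
≈ℝ-sym {x} {y} x≈y ε ε>0 =
  let N , p = x≈y ε ε>0
  in N , λ n le → ≡.subst (ℚ._< ε) (∣-∣-swap (seq x n) (seq y n)) (p n le)

≈ℝ-trans : ∀ {x y z} → x ≈ℝ y → y ≈ℝ z → x ≈ℝ z
≈ℝ-trans {x} {y} {z} x≈y y≈z ε ε>0 =
  let M , p = x≈y (½ ℚ.* ε) (half>0 ε>0)
      N , q = y≈z (½ ℚ.* ε) (half>0 ε>0)
  in M ℕ.⊔ N , λ n le → ℚ.≤-<-trans (triangle (seq x n) (seq y n) (seq z n))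
       (<-halves (p n (≤-maxˡ le)) (q n (≤-maxʳ {M} le)))

+ℝ-cong : ∀ {x y u v} → x ≈ℝ y → u ≈ℝ v → x +ℝ u ≈ℝ y +ℝ v
+ℝ-cong {x} {y} {u} {v} x≈y u≈v ε ε>0 =
  let M , p = x≈y (½ ℚ.* ε) (half>0 ε>0)
      N , q = u≈v (½ ℚ.* ε) (half>0 ε>0)
  in M ℕ.⊔ N , λ n le → +-close (seq x n) (seq u n) (seq y n) (seq v n)
       (p n (≤-maxˡ le)) (q n (≤-maxʳ {M} le))

-ℝ-cong : ∀ {x y} → x ≈ℝ y → -ℝ x ≈ℝ -ℝ y
-ℝ-cong {x} {y} x≈y ε ε>0 =
  let N , p = x≈y ε ε>0
  in N , λ n le → ≡.subst (ℚ._< ε) (neg (seq x n) (seq y n)) (p n le)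
  where
  neg : ∀ a b → ℚ.∣ a ℚ.- b ∣ ≡ ℚ.∣ ℚ.- a ℚ.- ℚ.- b ∣
  neg a b = ≡.trans (∣-∣-swap a b)
    (≡.cong ℚ.∣_∣ (solve 2 (λ a b → b :- a := :- a :- (:- b)) ≡.refl a b))
    where open +-*-Solver

*ℝ-cong : ∀ {x y u v} → x ≈ℝ y → u ≈ℝ v → x *ℝ u ≈ℝ y *ℝ v
*ℝ-cong {x} {y} {u} {v} x≈y u≈v ε ε>0 =
  let B , K , B>0 , bnd = bounded₂ x v
      δ , δ>0 , Bδ = shrink B>0 ε>0
      M , p = x≈y δ δ>0
      N , q = u≈v δ δ>0
  in K ℕ.⊔ (M ℕ.⊔ N) , λ n le →
       *-close (seq x n) (seq u n) (seq y n) (seq v n) B>0 Bδ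
         (proj₁ (bnd n (≤-maxˡ le))) (proj₂ (bnd n (≤-maxˡ le)))
         (p n (≤-maxˡ (≤-maxʳ {K} le))) (q n (≤-maxʳ {M} (≤-maxʳ {K} le)))

infix  4 _≈ℂ_
infixl 6 _+ℂ_
infixl 7 _*ℂ_
infix  8 -ℂ_

record ℂ : Set where
  constructor _+i_
  field
    re im : ℝ

open ℂ public

_≈ℂ_ : Rel ℂ 0ℓ
z ≈ℂ w = re z ≈ℝ re w × im z ≈ℝ im w

_+ℂ_ _*ℂ_ : ℂ → ℂ → ℂ
z +ℂ w = (re z +ℝ re w) +i (im z +ℝ im w)
z *ℂ w = (re z *ℝ re w +ℝ -ℝ (im z *ℝ im w)) +i (re z *ℝ im w +ℝ im z *ℝ re w)

-ℂ_ : ℂ → ℂ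
-ℂ z = (-ℝ re z) +i (-ℝ im z)

ι : ℚ → ℂ
ι p = fromℚ p +i fromℚ 0ℚ

≈ℂ-pointwise : ∀ {z w} → (∀ n → seq (re z) n ≡ seq (re w) n) →
               (∀ n → seq (im z) n ≡ seq (im w) n) → z ≈ℂ w
≈ℂ-pointwise {z} {w} p q = ≈ℝ-pointwise {re z} {re w} p , ≈ℝ-pointwise {im z} {im w} q

*ℂ-cong : ∀ {x y u v} → x ≈ℂ y → u ≈ℂ v → x *ℂ u ≈ℂ y *ℂ v
*ℂ-cong {x} {y} {u} {v} (p , p′) (r , r′) =
    +ℝ-cong {re x *ℝ re u} {re y *ℝ re v} { -ℝ (im x *ℝ im u)} { -ℝ (im y *ℝ im v)}
      (*ℝ-cong {re x} {re y} {re u} {re v} p r)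
      (-ℝ-cong {im x *ℝ im u} {im y *ℝ im v} (*ℝ-cong {im x} {im y} {im u} {im v} p′ r′))
  , +ℝ-cong {re x *ℝ im u} {re y *ℝ im v} {im x *ℝ re u} {im y *ℝ re v}
      (*ℝ-cong {re x} {re y} {im u} {im v} p r′)
      (*ℝ-cong {im x} {im y} {re u} {re v} p′ r)

module _ where
  open +-*-Solver

  *ℂ-assoc : ∀ x y z → (x *ℂ y) *ℂ z ≈ℂ x *ℂ (y *ℂ z)
  *ℂ-assoc (a +i b) (c +i d) (e +i f) = ≈ℂ-pointwise
    {((a +i b) *ℂ (c +i d)) *ℂ (e +i f)} {(a +i b) *ℂ ((c +i d) *ℂ (e +i f))}
    (λ n → solve 6 (λ a b c d e f →
      (a :* c :+ (:- (b :* d))) :* e :+ (:- ((a :* d :+ b :* c) :* f))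
      := a :* (c :* e :+ (:- (d :* f))) :+ (:- (b :* (c :* f :+ d :* e)))) ≡.refl
      (seq a n) (seq b n) (seq c n) (seq d n) (seq e n) (seq f n))
    (λ n → solve 6 (λ a b c d e f →
      (a :* c :+ (:- (b :* d))) :* f :+ (a :* d :+ b :* c) :* e
      := a :* (c :* f :+ d :* e) :+ b :* (c :* e :+ (:- (d :* f)))) ≡.refl
      (seq a n) (seq b n) (seq c n) (seq d n) (seq e n) (seq f n))

  *ℂ-comm : ∀ x y → x *ℂ y ≈ℂ y *ℂ x
  *ℂ-comm (a +i b) (c +i d) = ≈ℂ-pointwise
    {(a +i b) *ℂ (c +i d)} {(c +i d) *ℂ (a +i b)}
    (λ n → solve 4 (λ a b c d →
      a :* c :+ (:- (b :* d)) := c :* a :+ (:- (d :* b))) ≡.refl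
      (seq a n) (seq b n) (seq c n) (seq d n))
    (λ n → solve 4 (λ a b c d →
      a :* d :+ b :* c := c :* b :+ d :* a) ≡.refl
      (seq a n) (seq b n) (seq c n) (seq d n))

  *ℂ-identityˡ : ∀ x → ι 1ℚ *ℂ x ≈ℂ x
  *ℂ-identityˡ (a +i b) = ≈ℂ-pointwise {ι 1ℚ *ℂ (a +i b)} {a +i b}
    (λ n → solve 2 (λ a b → con 1ℚ :* a :+ (:- (con 0ℚ :* b)) := a) ≡.refl (seq a n) (seq b n))
    (λ n → solve 2 (λ a b → con 1ℚ :* b :+ con 0ℚ :* a := b) ≡.refl (seq a n) (seq b n))

  *ℂ-distribˡ : ∀ x y z → x *ℂ (y +ℂ z) ≈ℂ x *ℂ y +ℂ x *ℂ z
  *ℂ-distribˡ (a +i b) (c +i d) (e +i f) = ≈ℂ-pointwise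
    {(a +i b) *ℂ ((c +i d) +ℂ (e +i f))} {(a +i b) *ℂ (c +i d) +ℂ (a +i b) *ℂ (e +i f)}
    (λ n → solve 6 (λ a b c d e f →
      a :* (c :+ e) :+ (:- (b :* (d :+ f)))
      := (a :* c :+ (:- (b :* d))) :+ (a :* e :+ (:- (b :* f)))) ≡.refl
      (seq a n) (seq b n) (seq c n) (seq d n) (seq e n) (seq f n))
    (λ n → solve 6 (λ a b c d e f →
      a :* (d :+ f) :+ b :* (c :+ e)
      := (a :* d :+ b :* c) :+ (a :* f :+ b :* e)) ≡.refl
      (seq a n) (seq b n) (seq c n) (seq d n) (seq e n) (seq f n))

≈ℂ-trans : ∀ {x y z} → x ≈ℂ y → y ≈ℂ z → x ≈ℂ z
≈ℂ-trans {x} {y} {z} (p , p′) (r , r′) =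
  ≈ℝ-trans {re x} {re y} {re z} p r , ≈ℝ-trans {im x} {im y} {im z} p′ r′

+ℂ-cong : ∀ {x y u v} → x ≈ℂ y → u ≈ℂ v → x +ℂ u ≈ℂ y +ℂ v
+ℂ-cong {x} {y} {u} {v} (p , p′) (r , r′) =
  +ℝ-cong {re x} {re y} {re u} {re v} p r , +ℝ-cong {im x} {im y} {im u} {im v} p′ r′

*ℂ-identityʳ : ∀ x → x *ℂ ι 1ℚ ≈ℂ x
*ℂ-identityʳ x =
  ≈ℂ-trans {x *ℂ ι 1ℚ} {ι 1ℚ *ℂ x} {x} (*ℂ-comm x (ι 1ℚ)) (*ℂ-identityˡ x)

*ℂ-distribʳ : ∀ x y z → (y +ℂ z) *ℂ x ≈ℂ y *ℂ x +ℂ z *ℂ x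
*ℂ-distribʳ x y z =
  ≈ℂ-trans {(y +ℂ z) *ℂ x} {x *ℂ (y +ℂ z)} {y *ℂ x +ℂ z *ℂ x} (*ℂ-comm (y +ℂ z) x)
    (≈ℂ-trans {x *ℂ (y +ℂ z)} {x *ℂ y +ℂ x *ℂ z} {y *ℂ x +ℂ z *ℂ x} (*ℂ-distribˡ x y z)
      (+ℂ-cong {x *ℂ y} {y *ℂ x} {x *ℂ z} {z *ℂ x} (*ℂ-comm x y) (*ℂ-comm x z)))

ℂ-commutativeRing : CommutativeRing 0ℓ 0ℓ
ℂ-commutativeRing = record
  { Carrier = ℂ
  ; _≈_ = _≈ℂ_
  ; _+_ = _+ℂ_
  ; _*_ = _*ℂ_
  ; -_  = -ℂ_
  ; 0#  = ι 0ℚ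
  ; 1#  = ι 1ℚ
  ; isCommutativeRing = record
    { isRing = record
      { +-isAbelianGroup = record
        { isGroup = record
          { isMonoid = record
            { isSemigroup = record
              { isMagma = record
                { isEquivalence = record
                  { refl  = λ {x} → ≈ℝ-refl {re x} , ≈ℝ-refl {im x}
                  ; sym   = λ {x} {y} (p , q) → ≈ℝ-sym {re x} {re y} p , ≈ℝ-sym {im x} {im y} q
                  ; trans = λ {x} {y} {z} → ≈ℂ-trans {x} {y} {z}
                  }
                ; ∙-cong = λ {x} {y} {u} {v} → +ℂ-cong {x} {y} {u} {v}
                }
              ; assoc = λ x y z → ≈ℂ-pointwise {(x +ℂ y) +ℂ z} {x +ℂ (y +ℂ z)}
                  (λ n → ℚ.+-assoc (seq (re x) n) (seq (re y) n) (seq (re z) n))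
                  (λ n → ℚ.+-assoc (seq (im x) n) (seq (im y) n) (seq (im z) n))
              }
            ; identity =
                (λ x → ≈ℂ-pointwise {ι 0ℚ +ℂ x} {x}
                  (λ n → ℚ.+-identityˡ (seq (re x) n)) (λ n → ℚ.+-identityˡ (seq (im x) n)))
              , (λ x → ≈ℂ-pointwise {x +ℂ ι 0ℚ} {x}
                  (λ n → ℚ.+-identityʳ (seq (re x) n)) (λ n → ℚ.+-identityʳ (seq (im x) n)))
            }
          ; inverse =
              (λ x → ≈ℂ-pointwise { -ℂ x +ℂ x} {ι 0ℚ}
                (λ n → ℚ.+-inverseˡ (seq (re x) n)) (λ n → ℚ.+-inverseˡ (seq (im x) n)))
            , (λ x → ≈ℂ-pointwise {x +ℂ -ℂ x} {ι 0ℚ}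
                (λ n → ℚ.+-inverseʳ (seq (re x) n)) (λ n → ℚ.+-inverseʳ (seq (im x) n)))
          ; ⁻¹-cong = λ {x} {y} (p , q) →
              -ℝ-cong {re x} {re y} p , -ℝ-cong {im x} {im y} q
          }
        ; comm = λ x y → ≈ℂ-pointwise {x +ℂ y} {y +ℂ x}
            (λ n → ℚ.+-comm (seq (re x) n) (seq (re y) n))
            (λ n → ℚ.+-comm (seq (im x) n) (seq (im y) n))
        }
      ; *-cong = λ {x} {y} {u} {v} → *ℂ-cong {x} {y} {u} {v}
      ; *-assoc = *ℂ-assoc
      ; *-identity = *ℂ-identityˡ , *ℂ-identityʳ
      ; distrib = *ℂ-distribˡ , *ℂ-distribʳ
      }
    ; *-comm = *ℂ-comm
    }
  }

module ℂ-Ring = CommutativeRing ℂ-commutativeRing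
module ℂ-Exp = Exp ℂ-Ring.commutativeSemiring

Σℂ : List ℂ → ℂ
Σℂ = foldr _+ℂ_ (ι 0ℚ)

record Digraph (e : Level) (n : ℕ) : Set (lsuc e) where
  infix 4 _⟶_ _⟶?_
  field
    _⟶_      : Rel (Fin n) e
    _⟶?_     : Decidable _⟶_
    loopless : Irreflexive _≡_ _⟶_

subsets : ∀ n → List (Subset n)
subsets zero    = [] ∷ []
subsets (suc n) = map (inside ∷_) (subsets n) ++ map (outside ∷_) (subsets n)

∃Vec? : ∀ {n p} m {P : Vec (Fin n) m → Set p} → U.Decidable P → Dec (∃[ v ] P v)
∃Vec? zero    P? = map′ ([] ,_) (λ { ([] , p) → p }) (P? [])
∃Vec? (suc m) P? = map′ (λ { (x , v , p) → x ∷ v , p }) (λ { (x ∷ v , p) → x , v , p })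
                        (Fin.any? (λ x → ∃Vec? m (λ v → P? (x ∷ v))))

module _ {e n} (G : Digraph e n) where

  open Digraph G

  IsTournamentOn : Subset n → Set e
  IsTournamentOn T = ∀ u v → u ∈ T → v ∈ T → u ≢ v →
    (u ⟶ v × ¬ (v ⟶ u)) ⊎ (¬ (u ⟶ v) × v ⟶ u)

  _Lists_ : ∀ {m} → Vec (Fin n) m → Subset n → Set
  a Lists T = ∀ v → (v ∈ T → v Vec.∈ a) × (v Vec.∈ a → v ∈ T)

  -- AllPairs _⟶_ (a₁ ∷ … ∷ aₘ ∷ []) says that aᵢ ⟶ aⱼ whenever i < j.
  IsTransitive : ℕ → Subset n → Set e
  IsTransitive m T = ∃[ a ] (_Lists_ {m} a T × AllPairs _⟶_ a)

  -- A subtournament is identified with its vertex set: as soon as the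
  -- induced subgraph is a tournament, no proper subgraph on the same
  -- vertices is one.
  IsTransitiveSubtournament : ℕ → Subset n → Set e
  IsTransitiveSubtournament m T = ∣ T ∣ ≡ m × IsTournamentOn T × IsTransitive m T

  isTransitiveSubtournament? : ∀ m → U.Decidable (IsTransitiveSubtournament m)
  isTransitiveSubtournament? m T = (∣ T ∣ ℕ.≟ m) ×-dec tournament? ×-dec transitive?
    where
    tournament? : Dec (IsTournamentOn T)
    tournament? = Fin.all? λ u → Fin.all? λ v →
      (u ∈? T) →-dec ((v ∈? T) →-dec (¬? (u Fin.≟ v) →-dec
        (((u ⟶? v) ×-dec ¬? (v ⟶? u)) ⊎-dec (¬? (u ⟶? v) ×-dec (v ⟶? u)))))
    transitive? : Dec (IsTransitive m T)
    transitive? = ∃Vec? m λ a →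
      Fin.all? (λ v → ((v ∈? T) →-dec anyEntry? (v Fin.≟_) a)
                      ×-dec (anyEntry? (v Fin.≟_) a →-dec (v ∈? T)))
      ×-dec allPairs? _⟶?_ a

𝒦 : ∀ {e n} → ℕ → Digraph e n → ℕ
𝒦 {n = n} m G = length (filter (isTransitiveSubtournament? G m) (subsets n))

-- The library's HeytingField would add an apartness relation, which is
-- redundant here: equality in a finite field is decidable.
record FiniteField (c ℓ : Level) (q : ℕ) : Set (lsuc (c ⊔ ℓ)) where
  field
    commutativeRing : CommutativeRing c ℓ

  open CommutativeRing commutativeRing public

  field
    1≉0         : ¬ 1# ≈ 0#
    invertible  : ∀ x → ¬ x ≈ 0# → ∃[ y ] x * y ≈ 1#
    enumeration : Inverse (≡.setoid (Fin q)) setoid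

  elem : Fin q → Carrier
  elem = Inverse.to enumeration

  index : Carrier → Fin q
  index = Inverse.from enumeration

  _≟_ : Decidable _≈_
  x ≟ y = map′
    (λ eq → trans (sym (Inverse.strictlyInverseˡ enumeration x))
              (trans (reflexive (≡.cong elem eq)) (Inverse.strictlyInverseˡ enumeration y)))
    (Inverse.from-cong enumeration)
    (index x Fin.≟ index y)

  open Exp commutativeSemiring public using (_^_; ^-congˡ)

  *-nonZero : ∀ {x y} → ¬ x ≈ 0# → ¬ y ≈ 0# → ¬ x * y ≈ 0#
  *-nonZero {x} {y} x≉0 y≉0 xy≈0 with invertible x x≉0
  ... | z , xz≈1 = y≉0 (trans (sym (*-identityˡ y))
      (trans (*-congʳ (trans (sym xz≈1) (*-comm x z)))
      (trans (*-assoc z x y) (trans (*-congˡ xy≈0) (zeroʳ z)))))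

  ^-nonZero : ∀ {x} n → ¬ x ≈ 0# → ¬ x ^ n ≈ 0#
  ^-nonZero zero    x≉0 = 1≉0
  ^-nonZero (suc n) x≉0 = *-nonZero x≉0 (^-nonZero n x≉0)

  F*-rawMonoid : RawMonoid (c ⊔ ℓ) ℓ
  F*-rawMonoid = record
    { Carrier = Σ Carrier (λ x → ¬ x ≈ 0#)
    ; _≈_     = λ x y → proj₁ x ≈ proj₁ y
    ; _∙_     = λ (x , x≉0) (y , y≉0) → x * y , *-nonZero x≉0 y≉0
    ; ε       = 1# , 1≉0
    }

  open RawMonoid F*-rawMonoid public using () renaming (Carrier to F*)

module _ {c ℓ q} (F : FiniteField c ℓ q) where

  open FiniteField F

  S : ℕ → Carrier → Set (c ⊔ ℓ)
  S k x = ∃[ y ] (¬ y ≈ 0# × y ^ k ≈ x)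

  S? : ∀ k → U.Decidable (S k)
  S? k x = map′
    (λ { (i , p) → elem i , p })
    (λ { (y , y≉0 , eq) →
      let y′≈y = Inverse.strictlyInverseˡ enumeration y
      in index y , (λ y′≈0 → y≉0 (trans (sym y′≈y) y′≈0)) , trans (^-congˡ k y′≈y) eq })
    (Fin.any? (λ i → ¬? (elem i ≟ 0#) ×-dec ((elem i ^ k) ≟ x)))

  -- Vertex i stands for the field element elem i.
  Paley : ℕ → Digraph (c ⊔ ℓ) q
  Paley k = record
    { _⟶_      = λ i j → S k (elem j - elem i)
    ; _⟶?_     = λ i j → S? k (elem j - elem i)
    ; loopless = λ { ≡.refl (y , y≉0 , eq) → ^-nonZero k y≉0 (trans eq (-‿inverseʳ _)) }
    }

  -- Homomorphisms from the group F* into the multiplicative monoid of ℂ;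
  -- their values are automatically units.
  Character : Set (c ⊔ ℓ)
  Character = MonoidHomomorphism F*-rawMonoid ℂ-Ring.*-rawMonoid

  open MonoidHomomorphism using (⟦_⟧; ⟦⟧-cong; homo; ε-homo)

  infixr 8 _^χ_

  _^χ_ : Character → ℕ → Character
  χ ^χ s = record
    { ⟦_⟧ = λ x → ⟦ χ ⟧ x ℂ-Exp.^ s
    ; isMonoidHomomorphism = record
      { isMagmaHomomorphism = record
        { isRelHomomorphism = record
          { cong = λ {x} {y} x≈y →
              ℂ-Exp.^-congˡ s {⟦ χ ⟧ x} {⟦ χ ⟧ y} (⟦⟧-cong χ {x} {y} x≈y) }
        ; homo = λ x y → ℂ-Ring.trans
            {⟦ χ ⟧ (x ∙ y) ℂ-Exp.^ s} {(⟦ χ ⟧ x *ℂ ⟦ χ ⟧ y) ℂ-Exp.^ s}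
            {⟦ χ ⟧ x ℂ-Exp.^ s *ℂ ⟦ χ ⟧ y ℂ-Exp.^ s}
            (ℂ-Exp.^-congˡ s {⟦ χ ⟧ (x ∙ y)} {⟦ χ ⟧ x *ℂ ⟦ χ ⟧ y} (homo χ x y))
            (ℂ-Exp.^-distrib-* (⟦ χ ⟧ x) (⟦ χ ⟧ y) s)
        }
      ; ε-homo = ℂ-Ring.trans {⟦ χ ⟧ ε ℂ-Exp.^ s} {ι 1ℚ ℂ-Exp.^ s} {ι 1ℚ}
          (ℂ-Exp.^-congˡ s {⟦ χ ⟧ ε} {ι 1ℚ} (ε-homo χ)) (1^ s)
      }
    }
    where
    open RawMonoid F*-rawMonoid using (_∙_; ε)
    1^ : ∀ s → ι 1ℚ ℂ-Exp.^ s ≈ℂ ι 1ℚ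
    1^ zero    = ℂ-Ring.refl {ι 1ℚ}
    1^ (suc s) = ℂ-Ring.trans {ι 1ℚ *ℂ (ι 1ℚ ℂ-Exp.^ s)} {ι 1ℚ ℂ-Exp.^ s} {ι 1ℚ}
                   (ℂ-Ring.*-identityˡ (ι 1ℚ ℂ-Exp.^ s)) (1^ s)

  IsTrivial : Character → Set (c ⊔ ℓ)
  IsTrivial χ = ∀ x → ⟦ χ ⟧ x ≈ℂ ι 1ℚ

  HasOrder : Character → ℕ → Set (c ⊔ ℓ)
  HasOrder χ k = 1 ℕ.≤ k × IsTrivial (χ ^χ k) ×
                 (∀ j → 1 ℕ.≤ j → j ℕ.< k → ¬ IsTrivial (χ ^χ j))

  -- χ extended to all of F by χ(0) = 0, for trivial χ as well.
  extend : Character → Carrier → ℂ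
  extend χ x with x ≟ 0#
  ... | yes _   = ι 0ℚ
  ... | no  x≉0 = ⟦ χ ⟧ (x , x≉0)

  ΣF : (Carrier → ℂ) → ℂ
  ΣF f = RawMonoidDefinitions.sum ℂ-Ring.+-rawMonoid (λ i → f (elem i))

  J : Character → Character → ℂ
  J A B = ΣF (λ a → extend A a *ℂ extend B (1# - a))

  𝐑 : ℕ → Character → ℂ
  𝐑 k χ = Σℂ (map (λ (s , t) → J (χ ^χ s) (χ ^χ t))
                   (filter (λ (s , t) → ¬? (k ∣? (s ℕ.+ t)))
                           (cartesianProduct 1…k-1 1…k-1)))
    where
    1…k-1 : List ℕ
    1…k-1 = applyUpTo suc (k ℕ.∸ 1)

fromℤ : ℤ → ℂ
fromℤ i = ι (i ℚ./ 1)

{-# OPTIONS --safe #-}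
module Submission where

-- Write S for the group of nonzero k-th powers, s for its order, χ for the
-- character, and M for the number of z such that both z and 1 - z lie in S.
--
-- Counting gives 𝒦₃ = q s M.  A transitive tournament of order 3 is listed by
-- exactly one ordered triple a → b → c with a → c (𝒦₃≡#triples; uniqueness uses
-- that -1 is not in S, so that no edge is reversible).  Such a triple amounts to
-- an arbitrary a, an arbitrary c - a in S, and z = (b - a) / (c - a) subject to
-- z and 1 - z lying in S (#triples-at, 𝒦₃-Paley).
--
-- The character detects S: for x ≠ 0, the sum 1 + χ(x) + … + χ(x)^(k-1) is k
-- when x is in S and 0 otherwise (∑powers-unit).  The sum is k or 0 according
-- to whether χ(x) = 1.  Summing over x, orthogonality (∑χʲ≈0) shows that the
-- kernel of χ has (q - 1) / k elements.  It contains S, and S has at least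
-- (q - 1) / k elements because Yᵏ - x has at most k roots (#roots≤degree).  So
-- the kernel is S and q - 1 = k s.  No generator of the unit group is needed.
--
-- Then the sum of Jacobi sums is computed pointwise.  For z ≠ 0, 1 put u = χ(z)
-- and v = χ(1 - z).  The sum of uˢ vᵗ over 1 ≤ s, t < k is (kα - 1)(kβ - 1),
-- where α and β are the indicators of z ∈ S and 1 - z ∈ S.  The terms with
-- k dividing s + t have t = k - s and add up to kγ - 1, where γ is the
-- indicator of z / (1 - z) ∈ S (offDiagonal+diagonal, diagonal-inverse).
-- Summed over z, each of α, β, γ contributes s and the product αβ contributes
-- M, and the outcome is ℝ_k(q) + 3 k s = k² M + 2 q + 2 (k - 2)
-- (∑offDiagonal), that is, ℝ_k(q) + q - 2k + 1 = k² M.  For z = 1 the value of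
-- γ is the indicator of -1 ∈ S, which vanishes: q ≡ k + 1 mod 2k makes s and q
-- odd, so that -1 = yᵏ would give -1 = (-1)ˢ = y^(q-1) = 1 by Fermat, while
-- 2 ≠ 0 since q · 1 = 0 (-1∉S).
--
-- Equality of complex numbers is undecidable here, but it is stable under
-- double negation (≈ℂ-stable), and that suffices: the question whether
-- χ(x) = 1, asked of the finitely many x, may be answered by excluded middle
-- inside a proof of a stable statement.  Stability also gives the absence of
-- zero divisors in the form needed (*ℂ-cancel-0).

open import Defs
open import Algebra.Bundles using (CommutativeMonoid; CommutativeRing; CommutativeSemiring)
open import Algebra.Morphism.Bundles using (MonoidHomomorphism)
import Algebra.Properties.CommutativeMonoid.Sum as Sum
import Algebra.Properties.CommutativeSemigroup as CommutativeSemigroupProperties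
import Algebra.Properties.CommutativeSemiring.Exp as Exp
import Algebra.Properties.Monoid.Mult as MonoidMult
import Algebra.Properties.Ring as RingProperties
import Algebra.Properties.Semiring.Mult as Mult
import Algebra.Properties.Semiring.Sum as SemiringSum
import Algebra.Solver.Ring.NaturalCoefficients.Default as Solver
open import Data.Bool.Base using (true; false)
import Data.Bool.Properties as Bool
open import Data.Fin.Base using (Fin; zero; suc; toℕ; opposite)
import Data.Fin.Properties as Fin
open import Data.Fin.Subset using (Subset; inside; outside; ∣_∣; ⁅_⁆; _∪_; _∈_; _∉_)
open import Data.Fin.Subset.Properties using (⊆-antisym; ∪-identityˡ; x∈⁅x⁆; x∈⁅y⁆⇒x≡y; x∈p∪q⁺; x∈p∪q⁻; ∣⁅x⁆∣≡1)
open import Data.Integer.Base as ℤ using (ℤ; +_)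
import Data.Integer.Properties as ℤ
import Data.Integer.Solver as ℤSolver
open import Data.List.Base using (List; []; _∷_; _++_; map; filter; foldr; length; applyUpTo; cartesianProduct)
open import Data.List.Properties using (map-∘)
open import Data.Nat.Base as ℕ using (ℕ; zero; suc; z≤n; s≤s)
import Data.Nat.Properties as ℕ
open import Data.Nat.Divisibility using (_∣_; _∣?_; divides; *-cancelˡ-∣)
import Data.Nat.Solver as ℕSolver
open import Data.Product.Base using (∃-syntax; _×_; _,_; proj₁; proj₂)
open import Data.Rational.Base as ℚ using (ℚ; 0ℚ; 1ℚ; ½; _/_)
import Data.Rational.Properties as ℚ
open import Data.Rational.Solver using (module +-*-Solver)
import Data.Rational.Unnormalised.Base as ℚᵘ
import Data.Rational.Unnormalised.Properties as ℚᵘ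
open import Data.Sum.Base using (_⊎_; inj₁; inj₂)
open import Data.Vec.Base using (Vec; []; _∷_; here; there)
import Data.Vec.Membership.Propositional as Vec
import Data.Vec.Properties as Vec
open import Data.Vec.Relation.Unary.All using ([]; _∷_)
open import Data.Vec.Relation.Unary.AllPairs using ([]; _∷_)
import Data.Vec.Relation.Unary.Any as Any
open import Function.Base using (_∘_; case_of_)
open import Function.Bundles using (Inverse)
import Function.Construct.Composition as Composition
import Function.Construct.Symmetry as Symmetry
open import Level using (Level)
open import Relation.Binary.PropositionalEquality as ≡ using (_≡_; _≢_; _≗_)
import Relation.Binary.Reasoning.Setoid as SetoidReasoning
open import Relation.Nullary.Decidable using (Dec; yes; no; ¬?; _×-dec_; ¬¬-excluded-middle; decidable-stable)
open import Relation.Nullary.Negation using (¬_; contradiction)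
import Relation.Unary as U

private variable
  ℓ₁ ℓ₂ ℓ₃ : Level
  X : Set ℓ₁
  Y : Set ℓ₂
  n : ℕ

-- Real and complex numbers: stability, zero divisors, the embedding of ℚ.

-- Convergence to 0; x ≈ℝ y unfolds to Null (x +ℝ -ℝ y).
Null : ℝ → Set
Null x = ∀ ε → 0ℚ ℚ.< ε → ∃[ N ] (∀ n → N ℕ.≤ n → ℚ.∣ seq x n ∣ ℚ.< ε)

-- Eventually bounded away from 0: the positive form of ¬ Null.
Apart : ℝ → Set
Apart x = ∃[ δ ] (0ℚ ℚ.< δ × ∃[ N ] (∀ n → N ℕ.≤ n → δ ℚ.≤ ℚ.∣ seq x n ∣))

Null-cong : ∀ {x y} → (∀ n → seq x n ≡ seq y n) → Null x → Null y
Null-cong eq null ε ε>0 =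
  let N , p = null ε ε>0 in N , λ n le → ≡.subst (λ u → ℚ.∣ u ∣ ℚ.< ε) (eq n) (p n le)

-- Classically Null x or Apart x; this is the part that can be decided, one ε at
-- a time, by looking at a single late enough term of the sequence.
small-or-apart : ∀ x ε → 0ℚ ℚ.< ε →
  (∃[ N ] (∀ n → N ℕ.≤ n → ℚ.∣ seq x n ∣ ℚ.< ε)) ⊎ Apart x
small-or-apart x ε ε>0 = go (ℚ.∣ a ∣ ℚ.<? ½ ℚ.* ε)
  where
  η = ½ ℚ.* (½ ℚ.* ε)
  η>0 : 0ℚ ℚ.< η
  η>0 = half>0 (half>0 ε>0)
  N = proj₁ (cauchy x η η>0)
  close = proj₂ (cauchy x η η>0)
  a = seq x N
  η<½ε : η ℚ.< ½ ℚ.* ε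
  η<½ε = ≡.subst (η ℚ.<_) (halves (½ ℚ.* ε)) (<-+ʳ {η} {η} η>0)
  near : ∀ u v → ℚ.∣ u ∣ ℚ.≤ ℚ.∣ u ℚ.- v ∣ ℚ.+ ℚ.∣ v ∣
  near u v = ≡.subst (λ w → ℚ.∣ w ∣ ℚ.≤ ℚ.∣ u ℚ.- v ∣ ℚ.+ ℚ.∣ v ∣)
    (solve 2 (λ u v → (u :- v) :+ v := u) ≡.refl u v) (ℚ.∣p+q∣≤∣p∣+∣q∣ (u ℚ.- v) v)
    where open +-*-Solver
  go : _ → _
  go (yes a<) = inj₁ (N , λ n le → ℚ.≤-<-trans (near (seq x n) a)
         (<-halves (ℚ.<-trans (close n N le ℕ.≤-refl) η<½ε) a<))
  go (no  a≮) = inj₂ (η , η>0 , N , λ n le → ℚ.≮⇒≥ λ small →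
    ℚ.<-irrefl ≡.refl (ℚ.≤-<-trans (near a (seq x n))
      (ℚ.<-≤-trans (≡.subst (ℚ.∣ a ℚ.- seq x n ∣ ℚ.+ ℚ.∣ seq x n ∣ ℚ.<_) (halves (½ ℚ.* ε))
        (ℚ.+-mono-< (close N n ℕ.≤-refl le) small)) (ℚ.≮⇒≥ a≮))))

apart⇒¬null : ∀ {x} → Apart x → ¬ Null x
apart⇒¬null (δ , δ>0 , M , big) null =
  let N , small = null δ δ>0
  in ℚ.<-irrefl ≡.refl (ℚ.≤-<-trans (big (M ℕ.⊔ N) (ℕ.m≤m⊔n M N)) (small (M ℕ.⊔ N) (ℕ.m≤n⊔m M N)))

¬apart⇒null : ∀ x → ¬ Apart x → Null x
¬apart⇒null x ¬apart ε ε>0 with small-or-apart x ε ε>0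
... | inj₁ small = small
... | inj₂ apart = contradiction apart ¬apart

null-stable : ∀ x → ¬ ¬ Null x → Null x
null-stable x ¬¬null = ¬apart⇒null x λ apart → ¬¬null (apart⇒¬null {x} apart)

apart*null : ∀ {x y} → Apart x → Null (x *ℝ y) → Null y
apart*null {x} {y} (δ , δ>0 , M , big) null ε ε>0 =
  let N , small = null (δ ℚ.* ε) δε>0
  in M ℕ.⊔ N , λ n le → ℚ.≰⇒> λ ε≤ → ℚ.<-irrefl ≡.refl
    (ℚ.<-≤-trans (≡.subst (ℚ._< δ ℚ.* ε) (ℚ.∣p*q∣≡∣p∣*∣q∣ (seq x n) (seq y n)) (small n (≤-maxʳ {M} le)))
      (ℚ.≤-trans (ℚ.*-monoˡ-≤-nonNeg δ {{ℚ.pos⇒nonNeg δ {{ℚ.positive δ>0}}}} ε≤)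
        (ℚ.*-monoʳ-≤-nonNeg ℚ.∣ seq y n ∣ {{ℚ.∣-∣-nonNeg (seq y n)}} (big n (≤-maxˡ le)))))
  where
  δε>0 : 0ℚ ℚ.< δ ℚ.* ε
  δε>0 = ℚ.positive⁻¹ (δ ℚ.* ε) {{ℚ.pos*pos⇒pos δ {{ℚ.positive δ>0}} ε {{ℚ.positive ε>0}}}}

≈0⇒null : ∀ x → x ≈ℝ fromℚ 0ℚ → Null x
≈0⇒null x = Null-cong {x +ℝ -ℝ fromℚ 0ℚ} {x} (λ n → ℚ.+-identityʳ (seq x n))

null⇒≈0 : ∀ x → Null x → x ≈ℝ fromℚ 0ℚ
null⇒≈0 x = Null-cong {x} {x +ℝ -ℝ fromℚ 0ℚ} (λ n → ≡.sym (ℚ.+-identityʳ (seq x n)))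

≈ℂ-stable : ∀ z w → ¬ ¬ z ≈ℂ w → z ≈ℂ w
≈ℂ-stable z w ¬¬eq =
    null-stable (re z +ℝ -ℝ re w) (λ ¬p → ¬¬eq λ eq → ¬p (proj₁ eq))
  , null-stable (im z +ℝ -ℝ im w) (λ ¬p → ¬¬eq λ eq → ¬p (proj₂ eq))

-- The squared modulus.
∣_∣² : ℂ → ℝ
∣ z ∣² = re z *ℝ re z +ℝ im z *ℝ im z

-- The complex conjugate.
conj : ℂ → ℂ
conj z = re z +i (-ℝ im z)

private
  *-self : ∀ p → p ℚ.* p ≡ ℚ.∣ p ∣ ℚ.* ℚ.∣ p ∣
  *-self p with ℚ.∣p∣≡p∨∣p∣≡-p p
  ... | inj₁ eq rewrite eq = ≡.refl
  ... | inj₂ eq rewrite eq = solve 1 (λ a → a :* a := (:- a) :* (:- a)) ≡.refl p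
    where open +-*-Solver

  0≤p² : ∀ p → 0ℚ ℚ.≤ p ℚ.* p
  0≤p² p = ≡.subst (0ℚ ℚ.≤_) (≡.sym (*-self p))
    (ℚ.nonNegative⁻¹ _ {{ℚ.nonNeg*nonNeg⇒nonNeg ℚ.∣ p ∣ {{ℚ.∣-∣-nonNeg p}} ℚ.∣ p ∣ {{ℚ.∣-∣-nonNeg p}}}})

  δ²≤p² : ∀ {δ} p → 0ℚ ℚ.< δ → δ ℚ.≤ ℚ.∣ p ∣ → δ ℚ.* δ ℚ.≤ p ℚ.* p
  δ²≤p² {δ} p δ>0 δ≤ = ≡.subst (δ ℚ.* δ ℚ.≤_) (≡.sym (*-self p))
    (ℚ.≤-trans (ℚ.*-monoˡ-≤-nonNeg δ {{ℚ.pos⇒nonNeg δ {{ℚ.positive δ>0}}}} δ≤)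
      (ℚ.*-monoʳ-≤-nonNeg ℚ.∣ p ∣ {{ℚ.∣-∣-nonNeg p}} δ≤))

  ≤-abs : ∀ {p q} → 0ℚ ℚ.≤ p → p ℚ.≤ q → p ℚ.≤ ℚ.∣ q ∣
  ≤-abs {p} {q} 0≤p p≤q = ≡.subst (p ℚ.≤_) (≡.sym (ℚ.0≤p⇒∣p∣≡p (ℚ.≤-trans 0≤p p≤q))) p≤q

sum-of-squares-apartˡ : ∀ x y → Apart x → Apart (x *ℝ x +ℝ y *ℝ y)
sum-of-squares-apartˡ x y (δ , δ>0 , N , big) = δ ℚ.* δ , δ²>0 , N , λ n le →
  ≤-abs (ℚ.<⇒≤ δ²>0)
    (≡.subst (ℚ._≤ seq x n ℚ.* seq x n ℚ.+ seq y n ℚ.* seq y n) (ℚ.+-identityʳ (δ ℚ.* δ))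
      (ℚ.+-mono-≤ (δ²≤p² (seq x n) δ>0 (big n le)) (0≤p² (seq y n))))
  where
  δ²>0 : 0ℚ ℚ.< δ ℚ.* δ
  δ²>0 = ℚ.positive⁻¹ (δ ℚ.* δ) {{ℚ.pos*pos⇒pos δ {{ℚ.positive δ>0}} δ {{ℚ.positive δ>0}}}}

apart-cong : ∀ {x y} → (∀ n → seq x n ≡ seq y n) → Apart x → Apart y
apart-cong eq (δ , δ>0 , N , big) = δ , δ>0 , N , λ n le → ≡.subst (λ u → δ ℚ.≤ ℚ.∣ u ∣) (eq n) (big n le)

-- Multiplying z w ≈ 0 by the conjugate of z leaves ∣ z ∣² w ≈ 0.
norm-cancel : ∀ z w → Apart ∣ z ∣² → z *ℂ w ≈ℂ ι 0ℚ → w ≈ℂ ι 0ℚ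
norm-cancel z w apart zw≈0 =
    null⇒≈0 (re w) (apart*null {∣ z ∣²} {re w} apart
      (Null-cong {re zzw} {∣ z ∣² *ℝ re w}
        (λ n → solve 4 (λ a b c d →
          a :* (a :* c :+ (:- (b :* d))) :+ (:- ((:- b) :* (a :* d :+ b :* c)))
          := (a :* a :+ b :* b) :* c) ≡.refl
          (seq (re z) n) (seq (im z) n) (seq (re w) n) (seq (im w) n))
        (≈0⇒null (re zzw) (proj₁ zzw≈0))))
  , null⇒≈0 (im w) (apart*null {∣ z ∣²} {im w} apart
      (Null-cong {im zzw} {∣ z ∣² *ℝ im w}
        (λ n → solve 4 (λ a b c d →
          a :* (a :* d :+ b :* c) :+ (:- b) :* (a :* c :+ (:- (b :* d)))
          := (a :* a :+ b :* b) :* d) ≡.refl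
          (seq (re z) n) (seq (im z) n) (seq (re w) n) (seq (im w) n))
        (≈0⇒null (im zzw) (proj₂ zzw≈0))))
  where
  open +-*-Solver
  zzw = conj z *ℂ (z *ℂ w)
  zzw≈0 : zzw ≈ℂ ι 0ℚ
  zzw≈0 = ≈ℂ-trans {zzw} {conj z *ℂ ι 0ℚ} {ι 0ℚ}
    (*ℂ-cong {conj z} {conj z} {z *ℂ w} {ι 0ℚ} (ℂ-Ring.refl {conj z}) zw≈0) (ℂ-Ring.zeroʳ (conj z))

-- Neither part of z needs to be known to be apart from 0: w ≈ 0 is stable, and
-- if it failed then z could not be apart from 0 and would vanish.
*ℂ-cancel-0 : ∀ z w → ¬ z ≈ℂ ι 0ℚ → z *ℂ w ≈ℂ ι 0ℚ → w ≈ℂ ι 0ℚ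
*ℂ-cancel-0 z w z≉0 zw≈0 = ≈ℂ-stable w (ι 0ℚ) λ w≉0 →
  let ¬apart = λ apart → w≉0 (norm-cancel z w apart zw≈0)
  in z≉0 ( null⇒≈0 (re z) (¬apart⇒null (re z) λ apart →
             ¬apart (sum-of-squares-apartˡ (re z) (im z) apart))
         , null⇒≈0 (im z) (¬apart⇒null (im z) λ apart →
             ¬apart (apart-cong {im z *ℝ im z +ℝ re z *ℝ re z} {∣ z ∣²}
               (λ n → ℚ.+-comm (seq (im z) n ℚ.* seq (im z) n) (seq (re z) n ℚ.* seq (re z) n))
               (sum-of-squares-apartˡ (im z) (re z) apart))))

ι-cong : ∀ {p q} → p ≡ q → ι p ≈ℂ ι q
ι-cong {p} ≡.refl = ℂ-Ring.refl {ι p}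

ι-injective : ∀ {p q} → ι p ≈ℂ ι q → p ≡ q
ι-injective {p} {q} (eq , _) with p ℚ.≟ q
... | yes p≡q = p≡q
... | no  p≢q = contradiction (proj₂ (eq ℚ.∣ p ℚ.- q ∣ pos) _ ℕ.≤-refl) (ℚ.<-irrefl ≡.refl)
  where
  open +-*-Solver
  p-q≢0 : ℚ.∣ p ℚ.- q ∣ ≢ 0ℚ
  p-q≢0 eq′ = p≢q (≡.trans (solve 2 (λ a b → a := (a :- b) :+ b) ≡.refl p q)
    (≡.trans (≡.cong (ℚ._+ q) (ℚ.∣p∣≡0⇒p≡0 (p ℚ.- q) eq′)) (ℚ.+-identityˡ q)))
  pos : 0ℚ ℚ.< ℚ.∣ p ℚ.- q ∣
  pos = ℚ.≰⇒> λ ≤0 → p-q≢0 (ℚ.≤-antisym ≤0 (ℚ.0≤∣p∣ (p ℚ.- q)))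

ι-homo-+ : ∀ p q → ι (p ℚ.+ q) ≈ℂ ι p +ℂ ι q
ι-homo-+ p q = ≈ℂ-pointwise {ι (p ℚ.+ q)} {ι p +ℂ ι q} (λ _ → ≡.refl) (λ _ → ≡.refl)

ι-homo-* : ∀ p q → ι (p ℚ.* q) ≈ℂ ι p *ℂ ι q
ι-homo-* p q = ≈ℂ-pointwise {ι (p ℚ.* q)} {ι p *ℂ ι q}
  (λ _ → solve 2 (λ a b → a :* b := a :* b :+ (:- (con 0ℚ :* con 0ℚ))) ≡.refl p q)
  (λ _ → solve 2 (λ a b → con 0ℚ := a :* con 0ℚ :+ con 0ℚ :* b) ≡.refl p q)
  where open +-*-Solver

module ℂ-Mult = Mult ℂ-Ring.semiring

/1-homo-+ : ∀ i j → (i ℤ.+ j) / 1 ≡ i / 1 ℚ.+ j / 1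
/1-homo-+ i j = ℚ.toℚᵘ-injective (ℚᵘ.≃-trans (ℚ.toℚᵘ-fromℚᵘ (ℚᵘ.mkℚᵘ (i ℤ.+ j) 0))
  (ℚᵘ.≃-trans (ℚᵘ.*≡* (≡.cong (ℤ._* + 1) (≡.cong₂ ℤ._+_ (≡.sym (ℤ.*-identityʳ i)) (≡.sym (ℤ.*-identityʳ j)))))
  (ℚᵘ.≃-trans (ℚᵘ.+-cong {ℚᵘ.mkℚᵘ i 0} {ℚ.toℚᵘ (i / 1)} {ℚᵘ.mkℚᵘ j 0} {ℚ.toℚᵘ (j / 1)}
      (ℚᵘ.≃-sym (ℚ.toℚᵘ-fromℚᵘ (ℚᵘ.mkℚᵘ i 0))) (ℚᵘ.≃-sym (ℚ.toℚᵘ-fromℚᵘ (ℚᵘ.mkℚᵘ j 0))))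
    (ℚᵘ.≃-sym (ℚ.toℚᵘ-homo-+ (i / 1) (j / 1))))))

×1≈ι : ∀ n → n ℂ-Mult.× ι 1ℚ ≈ℂ fromℤ (+ n)
×1≈ι zero    = ℂ-Ring.refl {ι 0ℚ}
×1≈ι (suc n) = ≈ℂ-trans {ι 1ℚ +ℂ n ℂ-Mult.× ι 1ℚ} {ι 1ℚ +ℂ fromℤ (+ n)} {fromℤ (+ suc n)}
  (ℂ-Ring.+-congˡ {ι 1ℚ} {n ℂ-Mult.× ι 1ℚ} {fromℤ (+ n)} (×1≈ι n))
  (≈ℂ-trans {ι 1ℚ +ℂ fromℤ (+ n)} {ι (1ℚ ℚ.+ + n / 1)} {fromℤ (+ suc n)}
    (ℂ-Ring.sym {ι (1ℚ ℚ.+ + n / 1)} {ι 1ℚ +ℂ fromℤ (+ n)} (ι-homo-+ 1ℚ (+ n / 1)))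
    (ι-cong (≡.sym (/1-homo-+ (+ 1) (+ n)))))

/1-injective : ∀ {i j} → i / 1 ≡ j / 1 → i ≡ j
/1-injective {i} {j} eq with ℚ./-injective-≃ (ℚᵘ.mkℚᵘ i 0) (ℚᵘ.mkℚᵘ j 0) eq
... | ℚᵘ.*≡* p = ≡.trans (≡.sym (ℤ.*-identityʳ i)) (≡.trans p (ℤ.*-identityʳ j))

×1-injective : ∀ {m n} → m ℂ-Mult.× ι 1ℚ ≈ℂ n ℂ-Mult.× ι 1ℚ → m ≡ n
×1-injective {m} {n} eq = ℤ.+-injective (/1-injective (ι-injective
  (≈ℂ-trans {fromℤ (+ m)} {m ℂ-Mult.× ι 1ℚ} {fromℤ (+ n)}
    (ℂ-Ring.sym {m ℂ-Mult.× ι 1ℚ} {fromℤ (+ m)} (×1≈ι m))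
    (≈ℂ-trans {m ℂ-Mult.× ι 1ℚ} {n ℂ-Mult.× ι 1ℚ} {fromℤ (+ n)} eq (×1≈ι n)))))

-- Finite sums and indicator functions.

module ℕΣ = SemiringSum ℕ.+-*-semiring
open ℕΣ using () renaming (sum to ∑ℕ) public

-- The indicator of a decidable proposition.
𝟙 : Dec X → ℕ
𝟙 (yes _) = 1
𝟙 (no  _) = 0

𝟙-yes : (d : Dec X) → X → 𝟙 d ≡ 1
𝟙-yes (yes _) _ = ≡.refl
𝟙-yes (no ¬p) p = contradiction p ¬p

𝟙-no : (d : Dec X) → ¬ X → 𝟙 d ≡ 0
𝟙-no (yes p) ¬p = contradiction p ¬p
𝟙-no (no  _) _  = ≡.refl

𝟙≤1 : (d : Dec X) → 𝟙 d ℕ.≤ 1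
𝟙≤1 (yes _) = ℕ.≤-refl
𝟙≤1 (no  _) = z≤n

𝟙-mono : (X → Y) → (d : Dec X) (e : Dec Y) → 𝟙 d ℕ.≤ 𝟙 e
𝟙-mono f (yes p) e = ℕ.≤-reflexive (≡.sym (𝟙-yes e (f p)))
𝟙-mono f (no  _) e = z≤n

𝟙-cong : (X → Y) → (Y → X) → (d : Dec X) (e : Dec Y) → 𝟙 d ≡ 𝟙 e
𝟙-cong f g d e = ℕ.≤-antisym (𝟙-mono f d e) (𝟙-mono g e d)

𝟙-¬ : (d : Dec X) → 𝟙 (¬? d) ℕ.+ 𝟙 d ≡ 1
𝟙-¬ (yes _) = ≡.refl
𝟙-¬ (no  _) = ≡.refl

𝟙-× : (d : Dec X) (e : Dec Y) → 𝟙 (d ×-dec e) ≡ 𝟙 d ℕ.* 𝟙 e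
𝟙-× (yes _) (yes _) = ≡.refl
𝟙-× (yes _) (no  _) = ≡.refl
𝟙-× (no  _) (yes _) = ≡.refl
𝟙-× (no  _) (no  _) = ≡.refl

∑-const : ∀ n c → ∑ℕ {n} (λ _ → c) ≡ n ℕ.* c
∑-const zero    c = ≡.refl
∑-const (suc n) c = ≡.cong (c ℕ.+_) (∑-const n c)

∑-mono : ∀ {n} {f g : Fin n → ℕ} → (∀ i → f i ℕ.≤ g i) → ∑ℕ f ℕ.≤ ∑ℕ g
∑-mono {zero}  f≤g = z≤n
∑-mono {suc n} f≤g = ℕ.+-mono-≤ (f≤g zero) (∑-mono (f≤g ∘ suc))

term≤∑ : (f : Fin n → ℕ) → ∀ i → f i ℕ.≤ ∑ℕ f
term≤∑ f zero    = ℕ.m≤m+n (f zero) _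
term≤∑ f (suc i) = ℕ.≤-trans (term≤∑ (f ∘ suc) i) (ℕ.m≤n+m _ (f zero))

-- f ≤ g termwise with equal totals forces equality.
∑-squeeze : ∀ {n} {f g : Fin n → ℕ} → (∀ i → f i ℕ.≤ g i) → ∑ℕ g ℕ.≤ ∑ℕ f → f ≗ g
∑-squeeze {suc n} {f} {g} f≤g ∑g≤∑f zero = ℕ.≤-antisym (f≤g zero)
  (ℕ.+-cancelʳ-≤ (∑ℕ (g ∘ suc)) (g zero) (f zero)
    (ℕ.≤-trans ∑g≤∑f (ℕ.+-monoʳ-≤ (f zero) (∑-mono (f≤g ∘ suc)))))
∑-squeeze {suc n} {f} {g} f≤g ∑g≤∑f (suc i) = ∑-squeeze (f≤g ∘ suc)
  (ℕ.+-cancelˡ-≤ (g zero) _ _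
    (ℕ.≤-trans ∑g≤∑f (ℕ.+-monoˡ-≤ (∑ℕ (f ∘ suc)) (f≤g zero)))) i

module _ (M : CommutativeMonoid ℓ₁ ℓ₂) where
  open CommutativeMonoid M
  open Sum M

  sum-zero : ∀ {n} {f : Fin n → Carrier} → (∀ i → f i ≈ ε) → sum f ≈ ε
  sum-zero {n} f≈ε = trans (sum-cong-≋ f≈ε) (sum-replicate-zero n)

  sum-single : ∀ {n} (f : Fin n → Carrier) j → (∀ i → i ≢ j → f i ≈ ε) → sum f ≈ f j
  sum-single f zero    f≈ε = trans (∙-congˡ (sum-zero (λ i → f≈ε (suc i) λ ()))) (identityʳ _)
  sum-single f (suc j) f≈ε = trans (∙-congʳ (f≈ε zero λ ())) (trans (identityˡ _)
    (sum-single (f ∘ suc) j λ i i≢j → f≈ε (suc i) (i≢j ∘ Fin.suc-injective)))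

∑ℕ-single : ∀ {n} (f : Fin n → ℕ) j → (∀ i → i ≢ j → f i ≡ 0) → ∑ℕ f ≡ f j
∑ℕ-single = sum-single ℕ.+-0-commutativeMonoid

-- A finite choice principle: excluded middle may be assumed simultaneously for
-- the members of a finite family when a contradiction is sought.
¬¬-dec-all : (P : Fin n → Set ℓ₁) → ¬ ¬ (∀ i → Dec (P i))
¬¬-dec-all {n = zero}  P ¬all = ¬all λ ()
¬¬-dec-all {n = suc n} P ¬all = ¬¬-excluded-middle λ d → ¬¬-dec-all (P ∘ suc) λ ds →
  ¬all λ { zero → d ; (suc i) → ds i }

module _ (R : CommutativeSemiring ℓ₁ ℓ₂) where
  open CommutativeSemiring R
  open Exp R using (_^_)

  1^n≈1 : ∀ n → 1# ^ n ≈ 1#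
  1^n≈1 zero    = refl
  1^n≈1 (suc n) = trans (*-identityˡ _) (1^n≈1 n)

-- Finite fields.

module Field {c ℓ q} (F : FiniteField c ℓ q) where
  open FiniteField F hiding (zero)
  open RingProperties ring using (-‿involutive; -1*x≈-x; -‿+-comm; x[y-z]≈xy-xz)
  open Exp commutativeSemiring using (^-distrib-*; ^-assocʳ; ^-homo-*; ^-congʳ)

  elem-index : ∀ x → elem (index x) ≈ x
  elem-index = Inverse.strictlyInverseˡ enumeration

  elem-injective : ∀ {i j} → elem i ≈ elem j → i ≡ j
  elem-injective {i} {j} eq = ≡.trans (≡.sym (Inverse.strictlyInverseʳ enumeration i))
    (≡.trans (Inverse.from-cong enumeration eq) (Inverse.strictlyInverseʳ enumeration j))

  bijection : (f g : Carrier → Carrier) →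
    (∀ {x y} → x ≈ y → f x ≈ f y) → (∀ {x y} → x ≈ y → g x ≈ g y) →
    (∀ x → f (g x) ≈ x) → (∀ x → g (f x) ≈ x) → Inverse setoid setoid
  bijection f g f-cong g-cong fg gf = record
    { to = f ; from = g ; to-cong = f-cong ; from-cong = g-cong
    ; inverse = (λ {x} y≈ → trans (f-cong y≈) (fg x)) , (λ {x} y≈ → trans (g-cong y≈) (gf x)) }

  module SumF (M : CommutativeMonoid ℓ₁ ℓ₂) where
    private module M = CommutativeMonoid M
    open Sum M

    sum-bijection : (f : Carrier → M.Carrier) → (∀ {x y} → x ≈ y → f x M.≈ f y) →
      (φ : Inverse setoid setoid) →
      sum (λ i → f (elem i)) M.≈ sum (λ i → f (Inverse.to φ (elem i)))
    sum-bijection f f-cong φ = M.trans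
      (sum-permute (λ i → f (elem i))
        (Composition.inverse (Composition.inverse enumeration φ) (Symmetry.inverse enumeration)))
      (sum-cong-≋ λ i → f-cong (elem-index (Inverse.to φ (elem i))))

  -- The multiplicative inverse, extended by inv 0 = 0 so that it is a total
  -- involution of the field.
  inv : Carrier → Carrier
  inv x with x ≟ 0#
  ... | yes _   = 0#
  ... | no  x≉0 = proj₁ (invertible x x≉0)

  inv-0 : ∀ {x} → x ≈ 0# → inv x ≈ 0#
  inv-0 {x} x≈0 with x ≟ 0#
  ... | yes _   = refl
  ... | no  x≉0 = contradiction x≈0 x≉0

  inv-inverse : ∀ {x} → ¬ x ≈ 0# → x * inv x ≈ 1#
  inv-inverse {x} x≉0 with x ≟ 0#
  ... | yes x≈0  = contradiction x≈0 x≉0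
  ... | no  x≉0′ = proj₂ (invertible x x≉0′)

  *-cancelˡ : ∀ {x y z} → ¬ x ≈ 0# → x * y ≈ x * z → y ≈ z
  *-cancelˡ {x} {y} {z} x≉0 xy≈xz = trans (sym (divide y)) (trans (*-congˡ xy≈xz) (divide z))
    where
    divide : ∀ y → inv x * (x * y) ≈ y
    divide y = trans (sym (*-assoc _ _ _)) (trans (*-congʳ (trans (*-comm _ _) (inv-inverse x≉0))) (*-identityˡ y))

  inv-unique : ∀ {x y} → x * y ≈ 1# → inv x ≈ y
  inv-unique {x} {y} xy≈1 = *-cancelˡ x≉0 (trans (inv-inverse x≉0) (sym xy≈1))
    where
    x≉0 : ¬ x ≈ 0#
    x≉0 x≈0 = 1≉0 (trans (sym xy≈1) (trans (*-congʳ x≈0) (zeroˡ y)))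

  inv-cong : ∀ {x y} → x ≈ y → inv x ≈ inv y
  inv-cong {x} {y} x≈y = case y ≟ 0# of λ where
    (yes y≈0) → trans (inv-0 (trans x≈y y≈0)) (sym (inv-0 y≈0))
    (no  y≉0) → inv-unique (trans (*-congʳ x≈y) (inv-inverse y≉0))

  inv-involutive : ∀ x → inv (inv x) ≈ x
  inv-involutive x = case x ≟ 0# of λ where
    (yes x≈0) → trans (inv-0 (inv-0 x≈0)) (sym x≈0)
    (no  x≉0) → inv-unique (trans (*-comm _ _) (inv-inverse x≉0))

  inversion : Inverse setoid setoid
  inversion = bijection inv inv inv-cong inv-cong inv-involutive inv-involutive

  x+y-y : ∀ x y → (x + y) - y ≈ x
  x+y-y x y = trans (+-assoc _ _ _) (trans (+-congˡ (-‿inverseʳ y)) (+-identityʳ x))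

  x-y+y : ∀ x y → (x - y) + y ≈ x
  x-y+y x y = trans (+-assoc _ _ _) (trans (+-congˡ (-‿inverseˡ y)) (+-identityʳ x))

  y-[y-x] : ∀ y x → y - (y - x) ≈ x
  y-[y-x] y x = trans (+-congˡ (trans (sym (-‿+-comm y (- x))) (+-congˡ (-‿involutive x))))
    (trans (sym (+-assoc y (- y) x)) (trans (+-congʳ (-‿inverseʳ y)) (+-identityˡ x)))

  [y+u]-[y+x] : ∀ y u x → (y + u) - (y + x) ≈ u - x
  [y+u]-[y+x] y u x = trans (+-cong (+-comm y u) (sym (-‿+-comm y x)))
    (trans (sym (+-assoc (u + y) (- y) (- x))) (+-congʳ (x+y-y u y)))

  -‿cong₂ : ∀ {x y u v} → x ≈ y → u ≈ v → x - u ≈ y - v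
  -‿cong₂ x≈y u≈v = +-cong x≈y (-‿cong u≈v)

  translation : Carrier → Inverse setoid setoid
  translation y = bijection (_+ y) (λ x → x - y) +-congʳ +-congʳ (λ x → x-y+y x y) (λ x → x+y-y x y)

  reflection : Carrier → Inverse setoid setoid
  reflection y = bijection (λ x → y - x) (λ x → y - x) (-‿cong₂ refl) (-‿cong₂ refl) (y-[y-x] y) (y-[y-x] y)

  scaling : ∀ y → ¬ y ≈ 0# → Inverse setoid setoid
  scaling y y≉0 = bijection (y *_) (inv y *_) *-congˡ *-congˡ
    (λ x → trans (sym (*-assoc _ _ _)) (trans (*-congʳ (inv-inverse y≉0)) (*-identityˡ x)))
    (λ x → trans (sym (*-assoc _ _ _)) (trans (*-congʳ (trans (*-comm _ _) (inv-inverse y≉0))) (*-identityˡ x)))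

  -- The sum of a function over all field elements.
  ∑F : (Carrier → ℕ) → ℕ
  ∑F f = ∑ℕ (λ i → f (elem i))

  ∑F-bijection : (f : Carrier → ℕ) → (∀ {x y} → x ≈ y → f x ≡ f y) →
    (φ : Inverse setoid setoid) → ∑F f ≡ ∑F (f ∘ Inverse.to φ)
  ∑F-bijection = SumF.sum-bijection ℕ.+-0-commutativeMonoid

  ∑F-point : ∀ y → ∑F (λ x → 𝟙 (x ≟ y)) ≡ 1
  ∑F-point y = ≡.trans
    (∑ℕ-single _ (index y) λ i i≢ → 𝟙-no (elem i ≟ y) λ eq →
      i≢ (elem-injective (trans eq (sym (elem-index y)))))
    (𝟙-yes (elem (index y) ≟ y) (elem-index y))

  -- The number of units.
  #units : ℕ
  #units = ∑F (λ x → 𝟙 (¬? (x ≟ 0#)))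

  #units+1≡q : #units ℕ.+ 1 ≡ q
  #units+1≡q = begin
    #units ℕ.+ 1                                            ≡⟨ ≡.cong (#units ℕ.+_) (∑F-point 0#) ⟨
    #units ℕ.+ ∑F (λ x → 𝟙 (x ≟ 0#))                        ≡⟨ ℕΣ.∑-distrib-+ (λ i → 𝟙 (¬? (elem i ≟ 0#))) _ ⟨
    ∑F (λ x → 𝟙 (¬? (x ≟ 0#)) ℕ.+ 𝟙 (x ≟ 0#))               ≡⟨ ℕΣ.sum-cong-≗ (λ i → 𝟙-¬ (elem i ≟ 0#)) ⟩
    ∑F (λ _ → 1)                                            ≡⟨ ∑-const q 1 ⟩
    q ℕ.* 1                                                 ≡⟨ ℕ.*-identityʳ q ⟩
    q ∎
    where open ≡.≡-Reasoning

  private module ∏ = Sum *-commutativeMonoid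

  private
    -- The factor x when x is nonzero and 1 otherwise, so that a product over all
    -- field elements becomes the product over the units.
    orOne : ∀ {x} → Dec (x ≈ 0#) → Carrier
    orOne     (yes _) = 1#
    orOne {x} (no  _) = x

    orOne-cong : ∀ {x y} → x ≈ y → (d : Dec (x ≈ 0#)) (e : Dec (y ≈ 0#)) → orOne d ≈ orOne e
    orOne-cong x≈y (yes _) (yes _) = refl
    orOne-cong x≈y (no  _) (no  _) = x≈y
    orOne-cong x≈y (yes p) (no ¬p) = contradiction (trans (sym x≈y) p) ¬p
    orOne-cong x≈y (no ¬p) (yes p) = contradiction (trans x≈y p) ¬p

    orOne≉0 : ∀ {x} (d : Dec (x ≈ 0#)) → ¬ orOne d ≈ 0#
    orOne≉0 (yes _)   = 1≉0
    orOne≉0 (no  x≉0) = x≉0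

    orOne-* : ∀ {x y} → ¬ y ≈ 0# → (d : Dec (x ≈ 0#)) (e : Dec (y * x ≈ 0#)) →
              orOne e ≈ y ^ 𝟙 (¬? d) * orOne d
    orOne-* y≉0 (yes _)   (yes _)    = sym (*-identityˡ 1#)
    orOne-* y≉0 (yes x≈0) (no yx≉0)  = contradiction (trans (*-congˡ x≈0) (zeroʳ _)) yx≉0
    orOne-* y≉0 (no x≉0)  (yes yx≈0) = contradiction yx≈0 (*-nonZero y≉0 x≉0)
    orOne-* y≉0 (no _)    (no _)     = *-congʳ (sym (*-identityʳ _))

    ∏≉0 : ∀ {n} (f : Fin n → Carrier) → (∀ i → ¬ f i ≈ 0#) → ¬ ∏.sum f ≈ 0#
    ∏≉0 {zero}  f f≉0 = 1≉0
    ∏≉0 {suc n} f f≉0 = *-nonZero (f≉0 zero) (∏≉0 (f ∘ suc) (f≉0 ∘ suc))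

    ∏-^ : ∀ y {n} (f : Fin n → ℕ) → ∏.sum (λ i → y ^ f i) ≈ y ^ ∑ℕ f
    ∏-^ y {zero}  f = refl
    ∏-^ y {suc n} f = trans (*-congˡ (∏-^ y (f ∘ suc))) (sym (^-homo-* y (f zero) _))

  -- Multiplication by y permutes the units, hence fixes their product.
  fermat : ∀ {y} → ¬ y ≈ 0# → y ^ #units ≈ 1#
  fermat {y} y≉0 = *-cancelˡ Π≉0 (begin
    Π * y ^ #units                                               ≈⟨ *-comm _ _ ⟩
    y ^ #units * Π                                               ≈⟨ *-congʳ (∏-^ y (λ i → 𝟙 (¬? (elem i ≟ 0#)))) ⟨
    ∏.sum (λ i → y ^ 𝟙 (¬? (elem i ≟ 0#))) * Π                  ≈⟨ ∏.∑-distrib-+ (λ i → y ^ 𝟙 (¬? (elem i ≟ 0#))) (λ i → g (elem i)) ⟨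
    ∏.sum (λ i → y ^ 𝟙 (¬? (elem i ≟ 0#)) * g (elem i))         ≈⟨ ∏.sum-cong-≋ (λ i → orOne-* y≉0 (elem i ≟ 0#) ((y * elem i) ≟ 0#)) ⟨
    ∏.sum (λ i → g (y * elem i))                                 ≈⟨ SumF.sum-bijection *-commutativeMonoid g g-cong (scaling y y≉0) ⟨
    Π                                                            ≈⟨ *-identityʳ Π ⟨
    Π * 1#                                                       ∎)
    where
    open SetoidReasoning setoid
    g : Carrier → Carrier
    g x = orOne (x ≟ 0#)
    g-cong : ∀ {x y} → x ≈ y → g x ≈ g y
    g-cong {x} {y} x≈y = orOne-cong x≈y (x ≟ 0#) (y ≟ 0#)
    Π = ∏.sum (λ i → g (elem i))
    Π≉0 : ¬ Π ≈ 0#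
    Π≉0 = ∏≉0 (λ i → g (elem i)) (λ i → orOne≉0 (elem i ≟ 0#))

  private
    module +∑ = Sum +-commutativeMonoid
    open Mult semiring using () renaming (_×_ to _·_)
    module M = Mult semiring

  -- Translation by 1 fixes the sum of all field elements and adds q · 1 to it.
  q·1≈0 : q · 1# ≈ 0#
  q·1≈0 = sym (RingProperties.+-cancelˡ ring s 0# (q · 1#) (begin
    s + 0#                              ≈⟨ +-identityʳ s ⟩
    s                                   ≈⟨ SumF.sum-bijection +-commutativeMonoid (λ x → x) (λ e → e) (translation 1#) ⟩
    +∑.sum (λ i → elem i + 1#)          ≈⟨ +∑.∑-distrib-+ elem (λ _ → 1#) ⟩
    s + +∑.sum {q} (λ _ → 1#)           ≈⟨ +-congˡ (+∑.sum-replicate q) ⟩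
    s + q · 1#                          ∎))
    where
    open SetoidReasoning setoid
    s = +∑.sum elem

  odd⇒1+1≉0 : ∀ {m} → q ≡ suc (2 ℕ.* m) → ¬ 1# + 1# ≈ 0#
  odd⇒1+1≉0 {m} q≡ 1+1≈0 = 1≉0 (begin
    1#                         ≈⟨ +-identityʳ 1# ⟨
    1# + 0#                    ≈⟨ +-congˡ (zeroˡ (m · 1#)) ⟨
    1# + 0# * (m · 1#)         ≈⟨ +-congˡ (*-congʳ (trans (sym 1+1≈0) (+-congˡ (sym (+-identityʳ 1#))))) ⟩
    1# + (2 · 1#) * (m · 1#)   ≈⟨ +-congˡ (M.×1-homo-* 2 m) ⟨
    suc (2 ℕ.* m) · 1#         ≡⟨ ≡.cong (_· 1#) q≡ ⟨
    q · 1#                     ≈⟨ q·1≈0 ⟩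
    0#                         ∎)
    where open SetoidReasoning setoid

  -- Evaluation of monic polynomials: the vector c₀ ∷ … ∷ cₙ₋₁ ∷ [] stands for
  -- c₀ + c₁ y + … + cₙ₋₁ yⁿ⁻¹ + yⁿ, the leading coefficient being implicit.
  eval : ∀ {n} → Vec Carrier n → Carrier → Carrier
  eval []       y = 1#
  eval (c ∷ cs) y = c + y * eval cs y

  -- The quotient by y - r, computed by Horner's scheme.
  quotient : ∀ {n} → Carrier → Vec Carrier (suc n) → Vec Carrier n
  quotient r (c ∷ [])          = []
  quotient r (c ∷ cs@(_ ∷ _))  = eval cs r ∷ quotient r cs

  eval-quotient : ∀ {n} r (cs : Vec Carrier (suc n)) y →
                  eval cs y ≈ eval cs r + (y - r) * eval (quotient r cs) y
  eval-quotient r (c ∷ []) y = begin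
    c + y * 1#                           ≈⟨ +-congˡ (*-congʳ (sym (trans (+-comm _ _) (x-y+y y r)))) ⟩
    c + (r + (y - r)) * 1#               ≈⟨ +-congˡ (distribʳ _ _ _) ⟩
    c + (r * 1# + (y - r) * 1#)          ≈⟨ +-assoc _ _ _ ⟨
    c + r * 1# + (y - r) * 1#            ∎
    where open SetoidReasoning setoid
  eval-quotient r (c ∷ cs@(_ ∷ _)) y = begin
    c + y * eval cs y                    ≈⟨ +-congˡ (*-congˡ (eval-quotient r cs y)) ⟩
    c + y * (u + (y - r) * v)            ≈⟨ +-congˡ (distribˡ _ _ _) ⟩
    c + (y * u + y * ((y - r) * v))      ≈⟨ +-congˡ (+-cong
                                              (trans (*-congʳ (sym (trans (+-comm _ _) (x-y+y y r)))) (distribʳ _ _ _))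
                                              (trans (sym (*-assoc _ _ _)) (trans (*-congʳ (*-comm _ _)) (*-assoc _ _ _)))) ⟩
    c + ((r * u + (y - r) * u) + (y - r) * (y * v))  ≈⟨ +-congˡ (+-assoc _ _ _) ⟩
    c + (r * u + ((y - r) * u + (y - r) * (y * v)))  ≈⟨ +-congˡ (+-congˡ (distribˡ _ _ _)) ⟨
    c + (r * u + (y - r) * (u + y * v))  ≈⟨ +-assoc _ _ _ ⟨
    c + r * u + (y - r) * (u + y * v)    ∎
    where
    open SetoidReasoning setoid
    u = eval cs r
    v = eval (quotient r cs) y

  root-split : ∀ {n r y} (cs : Vec Carrier (suc n)) → eval cs r ≈ 0# → eval cs y ≈ 0# →
               ¬ y ≈ r → eval (quotient r cs) y ≈ 0#
  root-split {r = r} {y} cs er≈0 ey≈0 y≉r = *-cancelˡ y-r≉0 (begin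
    (y - r) * eval (quotient r cs) y               ≈⟨ +-identityˡ _ ⟨
    0# + (y - r) * eval (quotient r cs) y          ≈⟨ +-congʳ er≈0 ⟨
    eval cs r + (y - r) * eval (quotient r cs) y   ≈⟨ eval-quotient r cs y ⟨
    eval cs y                                      ≈⟨ ey≈0 ⟩
    0#                                             ≈⟨ zeroʳ _ ⟨
    (y - r) * 0#                                   ∎)
    where
    open SetoidReasoning setoid
    y-r≉0 : ¬ y - r ≈ 0#
    y-r≉0 eq = y≉r (trans (sym (x-y+y y r)) (trans (+-congʳ eq) (+-identityˡ r)))

  -- The number of roots in the field, counted without multiplicity.
  #roots : ∀ {n} → Vec Carrier n → ℕ
  #roots cs = ∑F (λ y → 𝟙 (eval cs y ≟ 0#))

  #roots≤degree : ∀ {n} (cs : Vec Carrier n) → #roots cs ℕ.≤ n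
  #roots≤degree [] = ℕ.≤-reflexive (sum-zero ℕ.+-0-commutativeMonoid {q} (λ i → 𝟙-no (1# ≟ 0#) 1≉0))
  #roots≤degree {suc n} cs with Fin.any? (λ i → eval cs (elem i) ≟ 0#)
  ... | no  none    = ℕ.≤-trans
      (ℕ.≤-reflexive (sum-zero ℕ.+-0-commutativeMonoid (λ i → 𝟙-no (eval cs (elem i) ≟ 0#) (λ eq → none (i , eq)))))
      z≤n
  ... | yes (j , e) = begin
    #roots cs                                                              ≤⟨ ∑-mono pointwise ⟩
    ∑F (λ y → 𝟙 (y ≟ r) ℕ.+ 𝟙 (eval (quotient r cs) y ≟ 0#))               ≡⟨ ℕΣ.∑-distrib-+ (λ i → 𝟙 (elem i ≟ r)) _ ⟩
    ∑F (λ y → 𝟙 (y ≟ r)) ℕ.+ #roots (quotient r cs)                        ≡⟨ ≡.cong (ℕ._+ #roots (quotient r cs)) (∑F-point r) ⟩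
    suc (#roots (quotient r cs))                                           ≤⟨ s≤s (#roots≤degree (quotient r cs)) ⟩
    suc n                                                                  ∎
    where
    open ℕ.≤-Reasoning
    r = elem j
    pointwise : ∀ i → 𝟙 (eval cs (elem i) ≟ 0#) ℕ.≤
                      𝟙 (elem i ≟ r) ℕ.+ 𝟙 (eval (quotient r cs) (elem i) ≟ 0#)
    pointwise i with eval cs (elem i) ≟ 0# | elem i ≟ r
    ... | no  _ | _       = z≤n
    ... | yes _ | yes _   = s≤s z≤n
    ... | yes z | no y≉r  = ℕ.≤-reflexive (≡.sym (𝟙-yes (eval (quotient r cs) (elem i) ≟ 0#) (root-split cs e z y≉r)))

  -- The polynomial yⁿ.
  monomial : ∀ n → Vec Carrier n
  monomial zero    = []
  monomial (suc n) = 0# ∷ monomial n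

  eval-monomial : ∀ n y → eval (monomial n) y ≈ y ^ n
  eval-monomial zero    y = refl
  eval-monomial (suc n) y = trans (+-identityˡ _) (*-congˡ (eval-monomial n y))

  #kth-roots≤k : ∀ k .{{_ : ℕ.NonZero k}} x → ∑F (λ y → 𝟙 ((y ^ k) ≟ x)) ℕ.≤ k
  #kth-roots≤k (suc k) x = ℕ.≤-trans
    (∑-mono λ i → 𝟙-mono (root (elem i)) ((elem i ^ suc k) ≟ x) (eval cs (elem i) ≟ 0#))
    (#roots≤degree cs)
    where
    cs : Vec Carrier (suc k)
    cs = (- x) ∷ monomial k
    root : ∀ y → y ^ suc k ≈ x → eval cs y ≈ 0#
    root y eq = trans (+-congˡ (trans (*-congˡ (eval-monomial k y)) eq)) (-‿inverseˡ x)

  inv≉0 : ∀ {x} → ¬ x ≈ 0# → ¬ inv x ≈ 0#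
  inv≉0 x≉0 inv≈0 = 1≉0 (trans (sym (inv-inverse x≉0)) (trans (*-congˡ inv≈0) (zeroʳ _)))

  -1²≈1 : (- 1#) ^ 2 ≈ 1#
  -1²≈1 = trans (*-congˡ (*-identityʳ _)) (trans (-1*x≈-x (- 1#)) (-‿involutive 1#))

  -- The k-th powers of units.
  module Powers (k : ℕ) where

    Sₖ : Carrier → Set _
    Sₖ = S F k

    S-cong : ∀ {x y} → x ≈ y → Sₖ x → Sₖ y
    S-cong x≈y (z , z≉0 , eq) = z , z≉0 , trans eq x≈y

    S-1 : Sₖ 1#
    S-1 = 1# , 1≉0 , 1^n≈1 commutativeSemiring k

    S≉0 : ∀ {x} → Sₖ x → ¬ x ≈ 0#
    S≉0 (y , y≉0 , eq) x≈0 = ^-nonZero k y≉0 (trans eq x≈0)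

    S-* : ∀ {x y} → Sₖ x → Sₖ y → Sₖ (x * y)
    S-* (u , u≉0 , p) (v , v≉0 , r) = u * v , *-nonZero u≉0 v≉0 , trans (^-distrib-* u v k) (*-cong p r)

    S-inv : ∀ {x} → Sₖ x → Sₖ (inv x)
    S-inv {x} (u , u≉0 , p) = inv u , inv≉0 u≉0 , sym (inv-unique (begin
      x * inv u ^ k      ≈⟨ *-congʳ p ⟨
      u ^ k * inv u ^ k  ≈⟨ ^-distrib-* u (inv u) k ⟨
      (u * inv u) ^ k    ≈⟨ ^-congˡ k (inv-inverse u≉0) ⟩
      1# ^ k             ≈⟨ 1^n≈1 commutativeSemiring k ⟩
      1#                 ∎))
      where open SetoidReasoning setoid

    S-cancel : ∀ {x y} → Sₖ x → Sₖ (x * y) → Sₖ y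
    S-cancel {x} {y} sx sxy = S-cong
      (trans (sym (*-assoc _ _ _)) (trans (*-congʳ (trans (*-comm _ _) (inv-inverse (S≉0 sx)))) (*-identityˡ y)))
      (S-* (S-inv sx) sxy)

    -- The indicator of S.
    𝟙S : Carrier → ℕ
    𝟙S x = 𝟙 (S? F k x)

    𝟙S-cong : ∀ {x y} → x ≈ y → 𝟙S x ≡ 𝟙S y
    𝟙S-cong {x} {y} x≈y = 𝟙-cong (S-cong x≈y) (S-cong (sym x≈y)) (S? F k x) (S? F k y)

    𝟙S-* : ∀ {x y} → Sₖ x → 𝟙S (x * y) ≡ 𝟙S y
    𝟙S-* {x} {y} sx = 𝟙-cong (S-cancel sx) (S-* sx) (S? F k (x * y)) (S? F k y)

    -- The order of S.
    #S : ℕ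
    #S = ∑F 𝟙S

    -- Every unit is a k-th root of its k-th power, and no element of S has more than
    -- k such roots.
    #units≤k*#S : .{{_ : ℕ.NonZero k}} → #units ℕ.≤ k ℕ.* #S
    #units≤k*#S = begin
      #units                                             ≡⟨ ℕΣ.sum-cong-≗ fibre ⟩
      ∑F (λ y → ∑F (λ x → unit y ℕ.* 𝟙 ((y ^ k) ≟ x)))   ≡⟨ ℕΣ.∑-comm (λ i j → unit (elem i) ℕ.* 𝟙 ((elem i ^ k) ≟ elem j)) ⟩
      ∑F (λ x → ∑F (λ y → unit y ℕ.* 𝟙 ((y ^ k) ≟ x)))   ≤⟨ ∑-mono (λ j → bound (elem j) (S? F k (elem j))) ⟩
      ∑F (λ x → k ℕ.* 𝟙S x)                              ≡⟨ ℕΣ.*-distribˡ-sum k (λ i → 𝟙S (elem i)) ⟨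
      k ℕ.* #S                                           ∎
      where
      open ℕ.≤-Reasoning
      unit : Carrier → ℕ
      unit y = 𝟙 (¬? (y ≟ 0#))
      fibre : ∀ i → unit (elem i) ≡ ∑F (λ x → unit (elem i) ℕ.* 𝟙 ((elem i ^ k) ≟ x))
      fibre i = ≡.trans (≡.sym (ℕ.*-identityʳ _)) (≡.trans
        (≡.cong (unit (elem i) ℕ.*_) (≡.sym (≡.trans
          (ℕΣ.sum-cong-≗ (λ j → 𝟙-cong sym sym ((elem i ^ k) ≟ elem j) (elem j ≟ (elem i ^ k))))
          (∑F-point (elem i ^ k)))))
        (ℕΣ.*-distribˡ-sum (unit (elem i)) (λ j → 𝟙 ((elem i ^ k) ≟ elem j))))
      bound : ∀ x (d : Dec (Sₖ x)) → ∑F (λ y → unit y ℕ.* 𝟙 ((y ^ k) ≟ x)) ℕ.≤ k ℕ.* 𝟙 d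
      bound x (yes _) = ℕ.≤-trans
        (∑-mono λ i → ℕ.≤-trans (ℕ.*-monoˡ-≤ (𝟙 ((elem i ^ k) ≟ x)) (𝟙≤1 (¬? (elem i ≟ 0#)))) (ℕ.≤-reflexive (ℕ.*-identityˡ _)))
        (ℕ.≤-trans (#kth-roots≤k k x) (ℕ.≤-reflexive (≡.sym (ℕ.*-identityʳ k))))
      bound x (no ¬s) = ℕ.≤-trans (ℕ.≤-reflexive (sum-zero ℕ.+-0-commutativeMonoid λ i → ≡.trans
        (≡.sym (𝟙-× (¬? (elem i ≟ 0#)) ((elem i ^ k) ≟ x)))
        (𝟙-no (¬? (elem i ≟ 0#) ×-dec ((elem i ^ k) ≟ x)) (λ (u , v) → ¬s (elem i , u , v))))) z≤n

    -- An odd power of -1 is -1, but the s-th power of a k-th power is 1 by Fermat.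
    -1∉S : ∀ {s m n} → #units ≡ k ℕ.* s → s ≡ suc (2 ℕ.* m) → q ≡ suc (2 ℕ.* n) → ¬ Sₖ (- 1#)
    -1∉S {s} {m} {n} units≡ s≡ q≡ (y , y≉0 , eq) = odd⇒1+1≉0 {n} q≡ (begin
      1# + 1#                     ≈⟨ +-congˡ (fermat y≉0) ⟨
      1# + y ^ #units             ≡⟨ ≡.cong (λ j → 1# + y ^ j) units≡ ⟩
      1# + y ^ (k ℕ.* s)          ≈⟨ +-congˡ (^-assocʳ y k s) ⟨
      1# + (y ^ k) ^ s            ≈⟨ +-congˡ (^-congˡ s eq) ⟩
      1# + (- 1#) ^ s             ≈⟨ +-congˡ odd-power ⟩
      1# - 1#                     ≈⟨ -‿inverseʳ 1# ⟩
      0#                          ∎)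
      where
      open SetoidReasoning setoid
      odd-power : (- 1#) ^ s ≈ - 1#
      odd-power = begin
        (- 1#) ^ s                  ≡⟨ ≡.cong ((- 1#) ^_) s≡ ⟩
        - 1# * (- 1#) ^ (2 ℕ.* m)   ≈⟨ *-congˡ (^-assocʳ (- 1#) 2 m) ⟨
        - 1# * ((- 1#) ^ 2) ^ m     ≈⟨ *-congˡ (trans (^-congˡ m -1²≈1) (1^n≈1 commutativeSemiring m)) ⟩
        - 1# * 1#                   ≈⟨ *-identityʳ _ ⟩
        - 1#                        ∎

    -- The number of z such that z and 1 - z are both k-th powers of units.
    #consecutive : ℕ
    #consecutive = ∑F (λ z → 𝟙S z ℕ.* 𝟙S (1# - z))

    -- The transitive triples a → b → c for a given a.  Substituting b = a + x and c = a + y turns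
    -- the conditions into x, y, y - x ∈ S; for y ∈ S, x = y z turns them into
    -- z, 1 - z ∈ S.
    #triples-at : ∀ a →
      ∑F (λ b → ∑F (λ c → 𝟙S (b - a) ℕ.* 𝟙S (c - a) ℕ.* 𝟙S (c - b))) ≡ #S ℕ.* #consecutive
    #triples-at a = begin
      ∑F (λ b → ∑F (λ c → 𝟙S (b - a) ℕ.* 𝟙S (c - a) ℕ.* 𝟙S (c - b)))  ≡⟨ ∑F-bijection _ (λ b≈ → ℕΣ.sum-cong-≗ λ i →
           ≡.cong₂ ℕ._*_ (≡.cong (ℕ._* 𝟙S (elem i - a)) (𝟙S-cong (+-congʳ b≈))) (𝟙S-cong (-‿cong₂ refl b≈))) (translation a) ⟩
      ∑F (λ x → ∑F (λ c → 𝟙S ((x + a) - a) ℕ.* 𝟙S (c - a) ℕ.* 𝟙S (c - (x + a))))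
        ≡⟨ ℕΣ.sum-cong-≗ (λ i → ∑F-bijection (λ c → 𝟙S ((elem i + a) - a) ℕ.* 𝟙S (c - a) ℕ.* 𝟙S (c - (elem i + a))) (λ c≈ → ≡.cong₂ ℕ._*_
           (≡.cong (𝟙S ((elem i + a) - a) ℕ.*_) (𝟙S-cong (+-congʳ c≈))) (𝟙S-cong (+-congʳ c≈))) (translation a)) ⟩
      ∑F (λ x → ∑F (λ y → 𝟙S ((x + a) - a) ℕ.* 𝟙S ((y + a) - a) ℕ.* 𝟙S ((y + a) - (x + a))))
        ≡⟨ ℕΣ.sum-cong-≗ (λ i → ℕΣ.sum-cong-≗ λ j → ≡.cong₂ ℕ._*_
             (≡.cong₂ ℕ._*_ (𝟙S-cong (x+y-y (elem i) a)) (𝟙S-cong (x+y-y (elem j) a)))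
             (𝟙S-cong (trans (-‿cong₂ (+-comm _ _) (+-comm _ _)) ([y+u]-[y+x] a (elem j) (elem i))))) ⟩
      ∑F (λ x → ∑F (λ y → 𝟙S x ℕ.* 𝟙S y ℕ.* 𝟙S (y - x)))  ≡⟨ ℕΣ.∑-comm (λ i j → 𝟙S (elem i) ℕ.* 𝟙S (elem j) ℕ.* 𝟙S (elem j - elem i)) ⟩
      ∑F (λ y → ∑F (λ x → 𝟙S x ℕ.* 𝟙S y ℕ.* 𝟙S (y - x)))  ≡⟨ ℕΣ.sum-cong-≗ (λ j → scale (elem j) (S? F k (elem j))) ⟩
      ∑F (λ y → 𝟙S y ℕ.* #consecutive)                     ≡⟨ ℕΣ.*-distribʳ-sum #consecutive (λ j → 𝟙S (elem j)) ⟨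
      #S ℕ.* #consecutive ∎
      where
      open ≡.≡-Reasoning
      scale : ∀ y (d : Dec (Sₖ y)) → ∑F (λ x → 𝟙S x ℕ.* 𝟙 d ℕ.* 𝟙S (y - x)) ≡ 𝟙 d ℕ.* #consecutive
      scale y (no _) = sum-zero ℕ.+-0-commutativeMonoid λ i → ≡.cong (ℕ._* 𝟙S (y - elem i)) (ℕ.*-zeroʳ (𝟙S (elem i)))
      scale y (yes sy) = begin
        ∑F (λ x → 𝟙S x ℕ.* 1 ℕ.* 𝟙S (y - x))
          ≡⟨ ℕΣ.sum-cong-≗ (λ i → ≡.cong (ℕ._* 𝟙S (y - elem i)) (ℕ.*-identityʳ (𝟙S (elem i)))) ⟩
        ∑F (λ x → 𝟙S x ℕ.* 𝟙S (y - x))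
          ≡⟨ ∑F-bijection (λ x → 𝟙S x ℕ.* 𝟙S (y - x)) (λ x≈ → ≡.cong₂ ℕ._*_ (𝟙S-cong x≈) (𝟙S-cong (-‿cong₂ refl x≈))) (scaling y (S≉0 sy)) ⟩
        ∑F (λ z → 𝟙S (y * z) ℕ.* 𝟙S (y - y * z))
          ≡⟨ ℕΣ.sum-cong-≗ (λ i → ≡.cong₂ ℕ._*_ (𝟙S-* sy) (≡.trans
               (𝟙S-cong (trans (+-congʳ (sym (*-identityʳ y))) (sym (x[y-z]≈xy-xz y 1# (elem i))))) (𝟙S-* sy))) ⟩
        #consecutive                           ≡⟨ ℕ.*-identityˡ #consecutive ⟨
        1 ℕ.* #consecutive ∎

-- Sums over lists.

module ListSum (M : CommutativeMonoid ℓ₁ ℓ₂) where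
  open CommutativeMonoid M
  open Sum M using (sum; sum-replicate-zero; ∑-distrib-+)
  open MonoidMult monoid using () renaming (_×_ to _·_)
  open CommutativeSemigroupProperties commutativeSemigroup using (x∙yz≈y∙xz)

  -- The sum of f over the entries of a list.
  sumₗ : (X → Carrier) → List X → Carrier
  sumₗ f xs = foldr _∙_ ε (map f xs)

  sumₗ-cong : {f g : X → Carrier} → (∀ x → f x ≈ g x) → ∀ xs → sumₗ f xs ≈ sumₗ g xs
  sumₗ-cong f≈g []       = refl
  sumₗ-cong f≈g (x ∷ xs) = ∙-cong (f≈g x) (sumₗ-cong f≈g xs)

  sumₗ-++ : (f : X → Carrier) → ∀ xs ys → sumₗ f (xs ++ ys) ≈ sumₗ f xs ∙ sumₗ f ys
  sumₗ-++ f []       ys = sym (identityˡ _)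
  sumₗ-++ f (x ∷ xs) ys = trans (∙-congˡ (sumₗ-++ f xs ys)) (sym (assoc _ _ _))

  sumₗ-map : (f : Y → Carrier) (g : X → Y) → ∀ xs → sumₗ f (map g xs) ≈ sumₗ (f ∘ g) xs
  sumₗ-map f g xs = reflexive (≡.cong (foldr _∙_ ε) (≡.sym (map-∘ xs)))

  sumₗ-sum : ∀ {n} (f : X → Fin n → Carrier) xs →
    sumₗ (λ x → sum (f x)) xs ≈ sum (λ i → sumₗ (λ x → f x i) xs)
  sumₗ-sum {n = n} f []       = sym (sum-replicate-zero n)
  sumₗ-sum         f (x ∷ xs) = trans (∙-congˡ (sumₗ-sum f xs)) (sym (∑-distrib-+ (f x) _))

  -- A sum splits into the part where P fails and the part where it holds.
  sumₗ-filter-¬ : {P : X → Set ℓ₃} (P? : U.Decidable P) (f : X → Carrier) → ∀ xs →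
    sumₗ f (filter (¬? ∘ P?) xs) ∙ sumₗ (λ x → 𝟙 (P? x) · f x) xs ≈ sumₗ f xs
  sumₗ-filter-¬ P? f []       = identityˡ ε
  sumₗ-filter-¬ P? f (x ∷ xs) with P? x
  ... | yes _ = trans (∙-congˡ (∙-congʳ (identityʳ (f x))))
                  (trans (x∙yz≈y∙xz _ _ _) (∙-congˡ (sumₗ-filter-¬ P? f xs)))
  ... | no  _ = trans (∙-congˡ (identityˡ _)) (trans (assoc _ _ _) (∙-congˡ (sumₗ-filter-¬ P? f xs)))

  sumₗ-cartesianProduct : (f : X × Y → Carrier) → ∀ xs ys →
    sumₗ f (cartesianProduct xs ys) ≈ sumₗ (λ x → sumₗ (λ y → f (x , y)) ys) xs
  sumₗ-cartesianProduct f []       ys = refl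
  sumₗ-cartesianProduct f (x ∷ xs) ys = trans (sumₗ-++ f (map (x ,_) ys) _)
    (∙-cong (sumₗ-map f (x ,_) ys) (sumₗ-cartesianProduct f xs ys))

  sumₗ-applyUpTo : (f : X → Carrier) (h : ℕ → X) → ∀ n →
    sumₗ f (applyUpTo h n) ≈ sum {n} (λ i → f (h (toℕ i)))
  sumₗ-applyUpTo f h zero    = refl
  sumₗ-applyUpTo f h (suc n) = ∙-congˡ (sumₗ-applyUpTo f (h ∘ suc) n)

open module ∑ₗ = ListSum ℕ.+-0-commutativeMonoid public using () renaming (sumₗ to ∑ₗ)

length-filter : {P : X → Set ℓ₃} (P? : U.Decidable P) → ∀ xs → length (filter P? xs) ≡ ∑ₗ (λ x → 𝟙 (P? x)) xs
length-filter P? [] = ≡.refl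
length-filter P? (x ∷ xs) with P? x
... | yes _ = ≡.cong suc (length-filter P? xs)
... | no  _ = length-filter P? xs

-- Transitive tournaments of order 3.

_≟ₛ_ : (T U : Subset n) → Dec (T ≡ U)
_≟ₛ_ = Vec.≡-dec Bool._≟_

∑ₗ-zero : {f : X → ℕ} → ∀ xs → (∀ x → f x ≡ 0) → ∑ₗ f xs ≡ 0
∑ₗ-zero []       f≡0 = ≡.refl
∑ₗ-zero (x ∷ xs) f≡0 = ≡.cong₂ ℕ._+_ (f≡0 x) (∑ₗ-zero xs f≡0)

-- Every subset occurs exactly once in the enumeration.
subsets-once : ∀ n (U : Subset n) → ∑ₗ (λ T → 𝟙 (T ≟ₛ U)) (subsets n) ≡ 1
subsets-once zero    []      = ≡.refl
subsets-once (suc n) (s ∷ U) = ≡.trans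
  (∑ₗ.sumₗ-++ (λ T → 𝟙 (T ≟ₛ (s ∷ U))) (map (inside ∷_) (subsets n)) _)
  (≡.trans (≡.cong₂ ℕ._+_ (∑ₗ.sumₗ-map (λ T → 𝟙 (T ≟ₛ (s ∷ U))) (inside ∷_) (subsets n))
                          (∑ₗ.sumₗ-map (λ T → 𝟙 (T ≟ₛ (s ∷ U))) (outside ∷_) (subsets n)))
           (split s))
  where
  same : ∀ s → ∑ₗ (λ T → 𝟙 ((s ∷ T) ≟ₛ (s ∷ U))) (subsets n) ≡ 1
  same s = ≡.trans
    (∑ₗ.sumₗ-cong (λ T → 𝟙-cong Vec.∷-injectiveʳ (≡.cong (s ∷_)) ((s ∷ T) ≟ₛ (s ∷ U)) (T ≟ₛ U)) (subsets n))
    (subsets-once n U)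
  other : ∀ {r s} → r ≢ s → ∑ₗ (λ T → 𝟙 ((r ∷ T) ≟ₛ (s ∷ U))) (subsets n) ≡ 0
  other {r} {s} r≢s = ∑ₗ-zero (subsets n) λ T → 𝟙-no ((r ∷ T) ≟ₛ (s ∷ U)) (r≢s ∘ Vec.∷-injectiveˡ)
  split : ∀ s → ∑ₗ (λ T → 𝟙 ((inside ∷ T) ≟ₛ (s ∷ U))) (subsets n) ℕ.+
                ∑ₗ (λ T → 𝟙 ((outside ∷ T) ≟ₛ (s ∷ U))) (subsets n) ≡ 1
  split true  = ≡.cong₂ ℕ._+_ (same inside) (other {outside} {inside} λ ())
  split false = ≡.cong₂ ℕ._+_ (other {inside} {outside} λ ()) (same outside)

∣⁅x⁆∪p∣ : ∀ (x : Fin n) p → x ∉ p → ∣ ⁅ x ⁆ ∪ p ∣ ≡ suc ∣ p ∣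
∣⁅x⁆∪p∣ zero    (true  ∷ p) x∉p = contradiction here x∉p
∣⁅x⁆∪p∣ zero    (false ∷ p) x∉p = ≡.cong (suc ∘ ∣_∣) (∪-identityˡ p)
∣⁅x⁆∪p∣ (suc x) (true  ∷ p) x∉p = ≡.cong suc (∣⁅x⁆∪p∣ x p (x∉p ∘ there))
∣⁅x⁆∪p∣ (suc x) (false ∷ p) x∉p = ∣⁅x⁆∪p∣ x p (x∉p ∘ there)

-- The set with elements a, b, c.
triple : (a b c : Fin n) → Subset n
triple a b c = ⁅ a ⁆ ∪ (⁅ b ⁆ ∪ ⁅ c ⁆)

∈-triple⁻ : ∀ {a b c v : Fin n} → v ∈ triple a b c → v ≡ a ⊎ v ≡ b ⊎ v ≡ c
∈-triple⁻ {a = a} {b} {c} v∈ with x∈p∪q⁻ ⁅ a ⁆ (⁅ b ⁆ ∪ ⁅ c ⁆) v∈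
... | inj₁ v∈a = inj₁ (x∈⁅y⁆⇒x≡y a v∈a)
... | inj₂ v∈bc with x∈p∪q⁻ ⁅ b ⁆ ⁅ c ⁆ v∈bc
...   | inj₁ v∈b = inj₂ (inj₁ (x∈⁅y⁆⇒x≡y b v∈b))
...   | inj₂ v∈c = inj₂ (inj₂ (x∈⁅y⁆⇒x≡y c v∈c))

∈-triple⁺ : ∀ {a b c v : Fin n} → v ≡ a ⊎ v ≡ b ⊎ v ≡ c → v ∈ triple a b c
∈-triple⁺ (inj₁ ≡.refl)        = x∈p∪q⁺ (inj₁ (x∈⁅x⁆ _))
∈-triple⁺ (inj₂ (inj₁ ≡.refl)) = x∈p∪q⁺ (inj₂ (x∈p∪q⁺ (inj₁ (x∈⁅x⁆ _))))
∈-triple⁺ (inj₂ (inj₂ ≡.refl)) = x∈p∪q⁺ (inj₂ (x∈p∪q⁺ (inj₂ (x∈⁅x⁆ _))))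

module _ (G : Digraph ℓ₃ n)
  (asym : ∀ {u v} → Digraph._⟶_ G u v → ¬ Digraph._⟶_ G v u) where

  open Digraph G

  irrefl : ∀ {u} → ¬ u ⟶ u
  irrefl = loopless ≡.refl

  -- The listing a, b, c exhibits T as a transitive subtournament.
  TransitiveTriple : Subset n → Fin n → Fin n → Fin n → Set ℓ₃
  TransitiveTriple T a b c = (a ⟶ b × a ⟶ c × b ⟶ c) × T ≡ triple a b c

  transitiveTriple? : ∀ T a b c → Dec (TransitiveTriple T a b c)
  transitiveTriple? T a b c = ((a ⟶? b) ×-dec (a ⟶? c) ×-dec (b ⟶? c)) ×-dec (T ≟ₛ triple a b c)

  triple⇒subtournament : ∀ {T a b c} → TransitiveTriple T a b c → IsTransitiveSubtournament G 3 T
  triple⇒subtournament {T} {a} {b} {c} ((ab , ac , bc) , ≡.refl) =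
      ≡.trans (∣⁅x⁆∪p∣ a _ a∉bc) (≡.cong suc (≡.trans (∣⁅x⁆∪p∣ b _ b∉c) (≡.cong suc (∣⁅x⁆∣≡1 c))))
    , (λ u v u∈ v∈ u≢v → tournament (∈-triple⁻ u∈) (∈-triple⁻ v∈) u≢v)
    , a ∷ b ∷ c ∷ [] , (λ v → listed ∘ ∈-triple⁻ , ∈-triple⁺ ∘ unlisted)
    , (ab ∷ ac ∷ []) ∷ (bc ∷ []) ∷ [] ∷ []
    where
    b∉c : b ∉ ⁅ c ⁆
    b∉c b∈ with x∈⁅y⁆⇒x≡y c b∈
    ... | ≡.refl = irrefl bc
    a∉bc : a ∉ ⁅ b ⁆ ∪ ⁅ c ⁆
    a∉bc a∈ with x∈p∪q⁻ ⁅ b ⁆ ⁅ c ⁆ a∈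
    ... | inj₁ a∈b with x∈⁅y⁆⇒x≡y b a∈b
    ...   | ≡.refl = irrefl ab
    a∉bc a∈ | inj₂ a∈c with x∈⁅y⁆⇒x≡y c a∈c
    ...   | ≡.refl = irrefl ac
    Linked : Fin n → Fin n → Set ℓ₃
    Linked u v = (u ⟶ v × ¬ v ⟶ u) ⊎ (¬ u ⟶ v × v ⟶ u)
    forth : ∀ {u v} → u ⟶ v → Linked u v
    forth uv = inj₁ (uv , asym uv)
    back : ∀ {u v} → v ⟶ u → Linked u v
    back vu = inj₂ (asym vu , vu)
    tournament : ∀ {u v} → u ≡ a ⊎ u ≡ b ⊎ u ≡ c → v ≡ a ⊎ v ≡ b ⊎ v ≡ c → u ≢ v → Linked u v
    tournament (inj₁ ≡.refl)        (inj₁ ≡.refl)        u≢v = contradiction ≡.refl u≢v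
    tournament (inj₁ ≡.refl)        (inj₂ (inj₁ ≡.refl)) u≢v = forth ab
    tournament (inj₁ ≡.refl)        (inj₂ (inj₂ ≡.refl)) u≢v = forth ac
    tournament (inj₂ (inj₁ ≡.refl)) (inj₁ ≡.refl)        u≢v = back ab
    tournament (inj₂ (inj₁ ≡.refl)) (inj₂ (inj₁ ≡.refl)) u≢v = contradiction ≡.refl u≢v
    tournament (inj₂ (inj₁ ≡.refl)) (inj₂ (inj₂ ≡.refl)) u≢v = forth bc
    tournament (inj₂ (inj₂ ≡.refl)) (inj₁ ≡.refl)        u≢v = back ac
    tournament (inj₂ (inj₂ ≡.refl)) (inj₂ (inj₁ ≡.refl)) u≢v = back bc
    tournament (inj₂ (inj₂ ≡.refl)) (inj₂ (inj₂ ≡.refl)) u≢v = contradiction ≡.refl u≢v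
    listed : ∀ {v} → v ≡ a ⊎ v ≡ b ⊎ v ≡ c → v Vec.∈ (a ∷ b ∷ c ∷ [])
    listed (inj₁ eq)        = Any.here eq
    listed (inj₂ (inj₁ eq)) = Any.there (Any.here eq)
    listed (inj₂ (inj₂ eq)) = Any.there (Any.there (Any.here eq))
    unlisted : ∀ {v} → v Vec.∈ (a ∷ b ∷ c ∷ []) → v ≡ a ⊎ v ≡ b ⊎ v ≡ c
    unlisted (Any.here eq)                         = inj₁ eq
    unlisted (Any.there (Any.here eq))             = inj₂ (inj₁ eq)
    unlisted (Any.there (Any.there (Any.here eq))) = inj₂ (inj₂ eq)

  subtournament⇒triple : ∀ {T} → IsTransitiveSubtournament G 3 T →
                         ∃[ a ] ∃[ b ] ∃[ c ] TransitiveTriple T a b c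
  subtournament⇒triple (_ , _ , (a ∷ b ∷ c ∷ []) , lists , (ab ∷ ac ∷ []) ∷ (bc ∷ []) ∷ [] ∷ []) =
    a , b , c , (ab , ac , bc) , ⊆-antisym
      (λ {v} v∈T → to (proj₁ (lists v) v∈T)) (λ {v} v∈ → proj₂ (lists v) (from (∈-triple⁻ v∈)))
    where
    to : ∀ {v} → v Vec.∈ (a ∷ b ∷ c ∷ []) → v ∈ triple a b c
    to (Any.here eq)                         = ∈-triple⁺ (inj₁ eq)
    to (Any.there (Any.here eq))             = ∈-triple⁺ (inj₂ (inj₁ eq))
    to (Any.there (Any.there (Any.here eq))) = ∈-triple⁺ {a = a} (inj₂ (inj₂ eq))
    from : ∀ {v} → v ≡ a ⊎ v ≡ b ⊎ v ≡ c → v Vec.∈ (a ∷ b ∷ c ∷ [])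
    from (inj₁ eq)        = Any.here eq
    from (inj₂ (inj₁ eq)) = Any.there (Any.here eq)
    from (inj₂ (inj₂ eq)) = Any.there (Any.there (Any.here eq))

  -- The first entry is the source of T and the last is the sink, both of which are
  -- determined by T because edges are not reversible.
  triple-unique : ∀ {T a b c a′ b′ c′} → TransitiveTriple T a b c → TransitiveTriple T a′ b′ c′ →
                  a ≡ a′ × b ≡ b′ × c ≡ c′
  triple-unique {T} {a} {b} {c} {a′} {b′} {c′} t@((ab , ac , bc) , T≡) t′@((a′b′ , a′c′ , b′c′) , T≡′) =
    a≡a′ , b≡b′ , c≡c′
    where
    member : ∀ {x y z v} → TransitiveTriple T x y z → v ∈ T → v ≡ x ⊎ v ≡ y ⊎ v ≡ z
    member (_ , ≡.refl) v∈ = ∈-triple⁻ v∈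
    source : ∀ {x y z v} → TransitiveTriple T x y z → v ∈ T → v ≡ x ⊎ x ⟶ v
    source t@((xy , xz , _) , _) v∈ with member t v∈
    ... | inj₁ eq             = inj₁ eq
    ... | inj₂ (inj₁ ≡.refl)  = inj₂ xy
    ... | inj₂ (inj₂ ≡.refl)  = inj₂ xz
    sink : ∀ {x y z v} → TransitiveTriple T x y z → v ∈ T → v ≡ z ⊎ v ⟶ z
    sink t@((_ , xz , yz) , _) v∈ with member t v∈
    ... | inj₁ ≡.refl         = inj₂ xz
    ... | inj₂ (inj₁ ≡.refl)  = inj₂ yz
    ... | inj₂ (inj₂ eq)      = inj₁ eq
    ∈T : ∀ {x y z v} → TransitiveTriple T x y z → v ≡ x ⊎ v ≡ y ⊎ v ≡ z → v ∈ T
    ∈T (_ , ≡.refl) = ∈-triple⁺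
    a≡a′ : a ≡ a′
    a≡a′ with source t (∈T t′ (inj₁ ≡.refl)) | source t′ (∈T t (inj₁ ≡.refl))
    ... | inj₁ eq | _       = ≡.sym eq
    ... | inj₂ _  | inj₁ eq = eq
    ... | inj₂ u  | inj₂ v  = contradiction v (asym u)
    c≡c′ : c ≡ c′
    c≡c′ with sink t (∈T t′ (inj₂ (inj₂ ≡.refl))) | sink t′ (∈T t (inj₂ (inj₂ ≡.refl)))
    ... | inj₁ eq | _       = ≡.sym eq
    ... | inj₂ _  | inj₁ eq = eq
    ... | inj₂ u  | inj₂ v  = contradiction v (asym u)
    b≡b′ : b ≡ b′
    b≡b′ with member t′ (∈T t (inj₂ (inj₁ ≡.refl)))
    ... | inj₁ b≡a′        = contradiction (≡.subst (a ⟶_) (≡.trans b≡a′ (≡.sym a≡a′)) ab) irrefl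
    ... | inj₂ (inj₁ eq)   = eq
    ... | inj₂ (inj₂ b≡c′) = contradiction (≡.subst (_⟶ c) (≡.trans b≡c′ (≡.sym c≡c′)) bc) irrefl

  -- The sum of f over all ordered triples of vertices.
  ∑³ : (Fin n → Fin n → Fin n → ℕ) → ℕ
  ∑³ f = ∑ℕ λ a → ∑ℕ λ b → ∑ℕ λ c → f a b c

  ∑³-cong : ∀ {f g} → (∀ a b c → f a b c ≡ g a b c) → ∑³ f ≡ ∑³ g
  ∑³-cong f≡g = ℕΣ.sum-cong-≗ λ a → ℕΣ.sum-cong-≗ λ b → ℕΣ.sum-cong-≗ λ c → f≡g a b c

  subtournament-indicator : ∀ T (d : Dec (IsTransitiveSubtournament G 3 T)) →
    𝟙 d ≡ ∑³ λ a b c → 𝟙 (transitiveTriple? T a b c)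
  subtournament-indicator T (no ¬t) = ≡.sym (zeros λ a → zeros λ b → zeros λ c →
    𝟙-no (transitiveTriple? T a b c) (¬t ∘ triple⇒subtournament))
    where
    zeros : ∀ {f : Fin n → ℕ} → (∀ i → f i ≡ 0) → ∑ℕ f ≡ 0
    zeros = sum-zero ℕ.+-0-commutativeMonoid
  subtournament-indicator T (yes t) with subtournament⇒triple t
  ... | a₀ , b₀ , c₀ , t₀ = ≡.sym (begin
    (∑³ λ a b c → 𝟙 (transitiveTriple? T a b c))     ≡⟨ ∑ℕ-single _ a₀ (λ a a≢ → zeros λ b → zeros λ c →
                                                        𝟙-no (transitiveTriple? T a b c) λ t → a≢ (proj₁ (triple-unique t t₀))) ⟩
    (∑ℕ λ b → ∑ℕ λ c → 𝟙 (transitiveTriple? T a₀ b c)) ≡⟨ ∑ℕ-single _ b₀ (λ b b≢ → zeros λ c →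
                                                        𝟙-no (transitiveTriple? T a₀ b c) λ t → b≢ (proj₁ (proj₂ (triple-unique t t₀)))) ⟩
    (∑ℕ λ c → 𝟙 (transitiveTriple? T a₀ b₀ c))       ≡⟨ ∑ℕ-single _ c₀ (λ c c≢ →
                                                        𝟙-no (transitiveTriple? T a₀ b₀ c) λ t → c≢ (proj₂ (proj₂ (triple-unique t t₀)))) ⟩
    𝟙 (transitiveTriple? T a₀ b₀ c₀)                 ≡⟨ 𝟙-yes (transitiveTriple? T a₀ b₀ c₀) t₀ ⟩
    1                                                ∎)
    where
    open ≡.≡-Reasoning
    zeros : ∀ {f : Fin n → ℕ} → (∀ i → f i ≡ 0) → ∑ℕ f ≡ 0
    zeros = sum-zero ℕ.+-0-commutativeMonoid

  𝒦₃≡#triples : 𝒦 3 G ≡ ∑³ λ a b c → 𝟙 (a ⟶? b) ℕ.* 𝟙 (a ⟶? c) ℕ.* 𝟙 (b ⟶? c)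
  𝒦₃≡#triples = begin
    𝒦 3 G
      ≡⟨ length-filter (isTransitiveSubtournament? G 3) (subsets n) ⟩
    ∑ₗ (λ T → 𝟙 (isTransitiveSubtournament? G 3 T)) (subsets n)
      ≡⟨ ∑ₗ.sumₗ-cong (λ T → subtournament-indicator T (isTransitiveSubtournament? G 3 T)) (subsets n) ⟩
    ∑ₗ (λ T → ∑³ λ a b c → 𝟙 (transitiveTriple? T a b c)) (subsets n)
      ≡⟨ ∑ₗ.sumₗ-sum (λ T a → ∑ℕ λ b → ∑ℕ λ c → 𝟙 (transitiveTriple? T a b c)) (subsets n) ⟩
    (∑ℕ λ a → ∑ₗ (λ T → ∑ℕ λ b → ∑ℕ λ c → 𝟙 (transitiveTriple? T a b c)) (subsets n))
      ≡⟨ ℕΣ.sum-cong-≗ (λ a → ∑ₗ.sumₗ-sum (λ T b → ∑ℕ λ c → 𝟙 (transitiveTriple? T a b c)) (subsets n)) ⟩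
    (∑ℕ λ a → ∑ℕ λ b → ∑ₗ (λ T → ∑ℕ λ c → 𝟙 (transitiveTriple? T a b c)) (subsets n))
      ≡⟨ ℕΣ.sum-cong-≗ (λ a → ℕΣ.sum-cong-≗ λ b → ∑ₗ.sumₗ-sum (λ T c → 𝟙 (transitiveTriple? T a b c)) (subsets n)) ⟩
    (∑³ λ a b c → ∑ₗ (λ T → 𝟙 (transitiveTriple? T a b c)) (subsets n))
      ≡⟨ ∑³-cong (λ a b c → once ((a ⟶? b) ×-dec (a ⟶? c) ×-dec (b ⟶? c)) (triple a b c)) ⟩
    (∑³ λ a b c → 𝟙 ((a ⟶? b) ×-dec (a ⟶? c) ×-dec (b ⟶? c)))
      ≡⟨ ∑³-cong (λ a b c → ≡.trans (𝟙-× (a ⟶? b) _) (≡.trans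
           (≡.cong (𝟙 (a ⟶? b) ℕ.*_) (𝟙-× (a ⟶? c) (b ⟶? c))) (≡.sym (ℕ.*-assoc (𝟙 (a ⟶? b)) _ _)))) ⟩
    (∑³ λ a b c → 𝟙 (a ⟶? b) ℕ.* 𝟙 (a ⟶? c) ℕ.* 𝟙 (b ⟶? c)) ∎
    where
    open ≡.≡-Reasoning
    once : {P : Set ℓ₃} (d : Dec P) (U : Subset n) → ∑ₗ (λ T → 𝟙 (d ×-dec (T ≟ₛ U))) (subsets n) ≡ 𝟙 d
    once d@(yes p) U = ≡.trans
      (∑ₗ.sumₗ-cong (λ T → 𝟙-cong proj₂ (p ,_) (d ×-dec (T ≟ₛ U)) (T ≟ₛ U)) (subsets n)) (subsets-once n U)
    once d@(no ¬p) U = ∑ₗ-zero (subsets n) λ T → 𝟙-no (d ×-dec (T ≟ₛ U)) (¬p ∘ proj₁)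

-- Pairs of exponents and power sums.

-- The list 1, …, k - 1.
indices : ℕ → List ℕ
indices k = applyUpTo suc (k ℕ.∸ 1)

-- The pairs (s , t) with 1 ≤ s, t < k and k not dividing s + t.
offDiagonalPairs : ℕ → List (ℕ × ℕ)
offDiagonalPairs k = filter (λ (s , t) → ¬? (k ∣? (s ℕ.+ t))) (cartesianProduct (indices k) (indices k))

-- With k = m + 1 and exponents s = 1 + i, t = 1 + j for i, j < m: as s + t lies
-- strictly between 0 and 2k, it is a multiple of k only if t = k - s, which is
-- to say that j = opposite i.
∣-sum-unique : ∀ {m} (i j : Fin m) → suc m ∣ suc (toℕ i) ℕ.+ suc (toℕ j) → j ≡ opposite i
∣-sum-unique {m} i j (divides zero ())
∣-sum-unique {m} i j (divides (suc zero) eq) = Fin.toℕ-injective (begin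
  toℕ j                                    ≡⟨ ℕ.m+n∸m≡n (suc (toℕ i)) (toℕ j) ⟨
  suc (toℕ i) ℕ.+ toℕ j ℕ.∸ suc (toℕ i)    ≡⟨ ≡.cong (ℕ._∸ suc (toℕ i)) (ℕ.suc-injective
                                               (≡.trans (≡.sym (ℕ.+-suc (suc (toℕ i)) (toℕ j))) (≡.trans eq (ℕ.*-identityˡ (suc m))))) ⟩
  m ℕ.∸ suc (toℕ i)                        ≡⟨ Fin.opposite-prop i ⟨
  toℕ (opposite i)                         ∎)
  where open ≡.≡-Reasoning
∣-sum-unique {m} i j (divides (suc (suc d)) eq) = contradiction (begin-strict
  suc (toℕ i) ℕ.+ suc (toℕ j)        ≤⟨ ℕ.+-mono-≤ (Fin.toℕ<n i) (Fin.toℕ<n j) ⟩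
  m ℕ.+ m                            <⟨ ℕ.+-mono-< (ℕ.n<1+n m) (ℕ.n<1+n m) ⟩
  suc m ℕ.+ suc m                    ≤⟨ ℕ.+-monoʳ-≤ (suc m) (ℕ.m≤m+n (suc m) (d ℕ.* suc m)) ⟩
  suc m ℕ.+ (suc m ℕ.+ d ℕ.* suc m)  ≡⟨ eq ⟨
  suc (toℕ i) ℕ.+ suc (toℕ j)        ∎) (ℕ.<-irrefl ≡.refl)
  where open ℕ.≤-Reasoning

suc+suc-opposite : ∀ {m} (i : Fin m) → suc (toℕ i) ℕ.+ suc (toℕ (opposite i)) ≡ suc m
suc+suc-opposite {m} i = begin
  suc (toℕ i) ℕ.+ suc (toℕ (opposite i))     ≡⟨ ℕ.+-suc (suc (toℕ i)) _ ⟩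
  suc (suc (toℕ i) ℕ.+ toℕ (opposite i))     ≡⟨ ≡.cong (λ t → suc (suc (toℕ i) ℕ.+ t)) (Fin.opposite-prop i) ⟩
  suc (suc (toℕ i) ℕ.+ (m ℕ.∸ suc (toℕ i)))  ≡⟨ ≡.cong suc (ℕ.m+[n∸m]≡n (Fin.toℕ<n i)) ⟩
  suc m                                      ∎
  where open ≡.≡-Reasoning

module RingSums (R : CommutativeRing ℓ₁ ℓ₂) where
  open CommutativeRing R hiding (zero)
  open Exp commutativeSemiring
  open SemiringSum semiring
  open Mult semiring using (×-homo-+; ×-congˡ; ×-homo-1) renaming (_×_ to _·_)
  open RingProperties ring using (+-cancelˡ)
  open ListSum +-commutativeMonoid

  -- The image of a natural number in the ring.
  ν : ℕ → Carrier
  ν n = n · 1#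

  ν-+ : ∀ m n → ν (m ℕ.+ n) ≈ ν m + ν n
  ν-+ = ×-homo-+ 1#

  ν-cong : ∀ {m n} → m ≡ n → ν m ≈ ν n
  ν-cong ≡.refl = refl

  ν-∑ : ∀ {n} (f : Fin n → ℕ) → sum (λ i → ν (f i)) ≈ ν (∑ℕ f)
  ν-∑ {zero}  f = refl
  ν-∑ {suc n} f = trans (+-congˡ (ν-∑ (f ∘ suc))) (sym (ν-+ (f zero) _))

  0^suc : ∀ {u} n → u ≈ 0# → u ^ suc n ≈ 0#
  0^suc n u≈0 = trans (*-congʳ u≈0) (zeroˡ _)

  -- u + u² + … + uᵐ.
  powerSum : ℕ → Carrier → Carrier
  powerSum m u = sum {m} (λ i → u ^ suc (toℕ i))

  powerSum-cong : ∀ m {u v} → u ≈ v → powerSum m u ≈ powerSum m v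
  powerSum-cong m u≈v = sum-cong-≋ {m} λ i → ^-congˡ (suc (toℕ i)) u≈v

  powerSum-0 : ∀ m {u} → u ≈ 0# → powerSum m u ≈ 0#
  powerSum-0 m u≈0 = sum-zero +-commutativeMonoid λ i → 0^suc (toℕ {m} i) u≈0

  powerSum-1 : ∀ m {u} → u ≈ 1# → 1# + powerSum m u ≈ ν (suc m)
  powerSum-1 m u≈1 = +-congˡ (trans
    (sum-cong-≋ {m} λ i → trans (^-congˡ (suc (toℕ {m} i)) u≈1) (1^n≈1 commutativeSemiring (suc (toℕ i)))) (sum-replicate m))

  -- Multiplication by u shifts 1 + u + … + uᵐ.
  geometric : ∀ m u → 1# + u * (1# + powerSum m u) ≈ (1# + powerSum m u) + u ^ suc m
  geometric m u = trans (+-congˡ (*-congˡ (G-suc m))) (trans (go (suc m)) (+-congʳ (sym (G-suc m))))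
    where
    G : ℕ → Carrier
    G n = sum {n} (λ i → u ^ toℕ i)
    G-suc : ∀ n → 1# + powerSum n u ≈ G (suc n)
    G-suc n = refl
    G-suc′ : ∀ n → G (suc n) ≈ 1# + u * G n
    G-suc′ n = +-congˡ (sym (*-distribˡ-sum u (λ i → u ^ toℕ {n} i)))
    go : ∀ n → 1# + u * G n ≈ G n + u ^ n
    go zero    = trans (+-congˡ (zeroʳ u)) (+-comm 1# 0#)
    go (suc n) = begin
      1# + u * G (suc n)             ≈⟨ +-congˡ (*-congˡ (trans (G-suc′ n) (go n))) ⟩
      1# + u * (G n + u ^ n)         ≈⟨ +-congˡ (distribˡ u (G n) (u ^ n)) ⟩
      1# + (u * G n + u ^ suc n)     ≈⟨ +-assoc _ _ _ ⟨
      (1# + u * G n) + u ^ suc n     ≈⟨ +-congʳ (G-suc′ n) ⟨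
      G (suc n) + u ^ suc n          ∎
      where open SetoidReasoning setoid

  geometric-fixed : ∀ m {u} → u ^ suc m ≈ 1# → u * (1# + powerSum m u) ≈ 1# + powerSum m u
  geometric-fixed m {u} uᵏ≈1 = +-cancelˡ 1# _ _
    (trans (geometric m u) (trans (+-congˡ uᵏ≈1) (+-comm _ 1#)))

  powerSum-* : ∀ m u v → powerSum m u * powerSum m v ≈
    sum {m} (λ i → sum {m} (λ j → u ^ suc (toℕ i) * v ^ suc (toℕ j)))
  powerSum-* m u v = trans (*-distribʳ-sum (powerSum m v) (λ i → u ^ suc (toℕ {m} i)))
    (sum-cong-≋ {m} λ i → *-distribˡ-sum (u ^ suc (toℕ i)) (λ j → v ^ suc (toℕ {m} j)))

  -- The sum of uˢ vᵗ over the pairs of exponents in 1, …, k - 1, for k = m + 1,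
  -- split into the part where k does not divide s + t and the part where it
  -- does.  The powers are given by functions f and g of the exponent because the
  -- powers of an extended character agree with the powers of its values only for
  -- positive exponents.
  module OffDiagonal (m : ℕ) (f g : ℕ → Carrier) {u v}
    (f≈ : ∀ s → f (suc s) ≈ u ^ suc s) (g≈ : ∀ s → g (suc s) ≈ v ^ suc s) where

    k : ℕ
    k = suc m

    -- The part where k does not divide s + t.
    offDiagonal : Carrier
    offDiagonal = sumₗ (λ (s , t) → f s * g t) (offDiagonalPairs k)

    -- The part where s + t = k.
    diagonal : Carrier
    diagonal = sum {m} (λ i → u ^ suc (toℕ i) * v ^ suc (toℕ (opposite i)))

    private
      product-sum : (h : ℕ × ℕ → Carrier) → sumₗ h (cartesianProduct (indices k) (indices k)) ≈
        sum {m} (λ i → sum {m} (λ j → h (suc (toℕ i) , suc (toℕ j))))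
      product-sum h = trans (sumₗ-cartesianProduct h (indices k) (indices k))
        (trans (sumₗ-applyUpTo (λ s → sumₗ (λ t → h (s , t)) (indices k)) suc m)
          (sum-cong-≋ {m} λ i → sumₗ-applyUpTo (λ t → h (suc (toℕ {m} i) , t)) suc m))

    offDiagonal+diagonal : offDiagonal + diagonal ≈ powerSum m u * powerSum m v
    offDiagonal+diagonal = begin
      offDiagonal + diagonal
        ≈⟨ +-congˡ (sym (trans (product-sum (λ x → 𝟙 (P? x) · h x)) (sum-cong-≋ {m} diag))) ⟩
      offDiagonal + sumₗ (λ x → 𝟙 (P? x) · h x) (cartesianProduct (indices k) (indices k))
        ≈⟨ sumₗ-filter-¬ P? h (cartesianProduct (indices k) (indices k)) ⟩
      sumₗ h (cartesianProduct (indices k) (indices k))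
        ≈⟨ product-sum h ⟩
      sum {m} (λ i → sum {m} (λ j → f (suc (toℕ i)) * g (suc (toℕ j))))
        ≈⟨ sum-cong-≋ {m} (λ i → sum-cong-≋ {m} λ j → *-cong (f≈ (toℕ i)) (g≈ (toℕ j))) ⟩
      sum {m} (λ i → sum {m} (λ j → u ^ suc (toℕ i) * v ^ suc (toℕ j)))
        ≈⟨ powerSum-* m u v ⟨
      powerSum m u * powerSum m v ∎
      where
      open SetoidReasoning setoid
      P? : ∀ (x : ℕ × ℕ) → Dec (k ∣ proj₁ x ℕ.+ proj₂ x)
      P? (s , t) = k ∣? (s ℕ.+ t)
      h : ℕ × ℕ → Carrier
      h (s , t) = f s * g t
      diag : ∀ (i : Fin m) → sum {m} (λ j → 𝟙 (P? (suc (toℕ i) , suc (toℕ j))) · h (suc (toℕ i) , suc (toℕ j)))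
             ≈ u ^ suc (toℕ i) * v ^ suc (toℕ (opposite i))
      diag i = trans
        (sum-single +-commutativeMonoid
          (λ j → 𝟙 (P? (suc (toℕ i) , suc (toℕ j))) · h (suc (toℕ i) , suc (toℕ j)))
          (opposite i) λ j j≢ →
          ×-congˡ {h (suc (toℕ i) , suc (toℕ j))} (𝟙-no (P? (suc (toℕ i) , suc (toℕ j))) (j≢ ∘ ∣-sum-unique i j)))
        (trans (×-congˡ {h (suc (toℕ i) , suc (toℕ (opposite i)))} (𝟙-yes (P? (suc (toℕ i) , suc (toℕ (opposite i))))
                 (divides 1 (≡.trans (suc+suc-opposite i) (≡.sym (ℕ.*-identityˡ k))))))
          (trans (×-homo-1 _) (*-cong (f≈ (toℕ i)) (g≈ (toℕ (opposite i))))))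

    -- uˢ vᵏ⁻ˢ = (u w)ˢ when w is the inverse of v and vᵏ = 1.
    diagonal-inverse : ∀ {w} → v ^ k ≈ 1# → v * w ≈ 1# → diagonal ≈ powerSum m (u * w)
    diagonal-inverse {w} vᵏ≈1 vw≈1 = sum-cong-≋ {m} λ i →
      let s = suc (toℕ i) ; t = suc (toℕ (opposite i)) in begin
      u ^ s * v ^ t                    ≈⟨ *-congˡ (*-identityʳ _) ⟨
      u ^ s * (v ^ t * 1#)             ≈⟨ *-congˡ (*-congˡ (trans (^-congˡ s vw≈1) (1^n≈1 commutativeSemiring s))) ⟨
      u ^ s * (v ^ t * (v * w) ^ s)    ≈⟨ *-congˡ (*-congˡ (^-distrib-* v w s)) ⟩
      u ^ s * (v ^ t * (v ^ s * w ^ s)) ≈⟨ *-congˡ (*-assoc _ _ _) ⟨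
      u ^ s * (v ^ t * v ^ s * w ^ s)  ≈⟨ *-congˡ (*-congʳ (trans (*-comm _ _) (trans (sym (^-homo-* v s t))
                                           (trans (^-congʳ v (suc+suc-opposite i)) vᵏ≈1)))) ⟩
      u ^ s * (1# * w ^ s)             ≈⟨ *-congˡ (*-identityˡ _) ⟩
      u ^ s * w ^ s                    ≈⟨ ^-distrib-* u w s ⟨
      (u * w) ^ s                      ∎
      where open SetoidReasoning setoid

    offDiagonal-0 : u ≈ 0# ⊎ v ≈ 0# → offDiagonal ≈ 0#
    offDiagonal-0 u≈0⊎v≈0 = begin
      offDiagonal                  ≈⟨ +-identityʳ _ ⟨
      offDiagonal + 0#             ≈⟨ +-congˡ (sum-zero +-commutativeMonoid {m} λ i → diagonal-term i u≈0⊎v≈0) ⟨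
      offDiagonal + diagonal       ≈⟨ offDiagonal+diagonal ⟩
      powerSum m u * powerSum m v  ≈⟨ product u≈0⊎v≈0 ⟩
      0#                           ∎
      where
      open SetoidReasoning setoid
      diagonal-term : ∀ i → u ≈ 0# ⊎ v ≈ 0# → u ^ suc (toℕ i) * v ^ suc (toℕ (opposite i)) ≈ 0#
      diagonal-term i (inj₁ u≈0) = trans (*-congʳ (0^suc (toℕ i) u≈0)) (zeroˡ _)
      diagonal-term i (inj₂ v≈0) = trans (*-congˡ (0^suc (toℕ (opposite i)) v≈0)) (zeroʳ _)
      product : u ≈ 0# ⊎ v ≈ 0# → powerSum m u * powerSum m v ≈ 0#
      product (inj₁ u≈0) = trans (*-congʳ (powerSum-0 m u≈0)) (zeroˡ _)
      product (inj₂ v≈0) = trans (*-congˡ (powerSum-0 m v≈0)) (zeroʳ _)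

-- Character sums.

-- A multiplicative character of order k = k′ + 2, extended by 0, with values in a
-- commutative ring.  Of the ring only three properties are used: its equality is
-- stable, it has no zero divisors in the sense of cancel-0, and it has
-- characteristic 0.
module CharacterSums {c ℓ r ℓr q} (F : FiniteField c ℓ q) (R : CommutativeRing r ℓr) (k′ : ℕ) where

  open CommutativeRing R hiding (zero)
  open RingSums R
  open Exp commutativeSemiring
  open SemiringSum semiring
  open ListSum +-commutativeMonoid using (sumₗ; sumₗ-cong; sumₗ-sum)
  open RingProperties ring using (x∙y⁻¹≈ε⇒x≈y; [y-z]x≈yx-zx; x≈y⇒x∙y⁻¹≈ε)
  open Field F
  open SetoidReasoning setoid
  private module F = FiniteField F

  m k : ℕ
  m = suc k′
  k = suc m

  open Powers k

  module WithCharacter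
    (stable      : ∀ x y → ¬ ¬ x ≈ y → x ≈ y)
    (cancel-0    : ∀ x y → ¬ x ≈ 0# → x * y ≈ 0# → y ≈ 0#)
    (ν-injective : ∀ {m n} → ν m ≈ ν n → m ≡ n)
    (χ : F.Carrier → Carrier)
    (χ-cong : ∀ {x y} → x F.≈ y → χ x ≈ χ y)
    (χ-0 : ∀ {x} → x F.≈ F.0# → χ x ≈ 0#)
    (χ-1 : χ F.1# ≈ 1#)
    (χ-* : ∀ x y → χ (x F.* y) ≈ χ x * χ y)
    (χᵏ≈1 : ∀ {x} → ¬ x F.≈ F.0# → χ x ^ k ≈ 1#)
    (χʲ-nontrivial : ∀ j → 1 ℕ.≤ j → j ℕ.< k → ¬ (∀ x → ¬ x F.≈ F.0# → χ x ^ j ≈ 1#))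
    where

    private
      fixed⇒0 : ∀ {u x} → ¬ u ≈ 1# → u * x ≈ x → x ≈ 0#
      fixed⇒0 {u} {x} u≉1 ux≈x = cancel-0 _ _ (u≉1 ∘ x∙y⁻¹≈ε⇒x≈y u 1#)
        (trans ([y-z]x≈yx-zx x u 1#) (x≈y⇒x∙y⁻¹≈ε (trans ux≈x (sym (*-identityˡ x)))))

    -- Orthogonality.  If the sum did not vanish, invariance under scaling by y would
    -- give χ(y)ʲ = 1 for every unit y.
    ∑χʲ≈0 : ∀ {j} → 1 ℕ.≤ j → j ℕ.< k → sum (λ i → χ (F.elem i) ^ j) ≈ 0#
    ∑χʲ≈0 {j} 1≤j j<k = stable _ _ λ s≉0 → χʲ-nontrivial j 1≤j j<k λ y y≉0 → stable _ _ λ χʲ≉1 →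
      s≉0 (fixed⇒0 χʲ≉1 (sym (begin
        s                                              ≈⟨ SumF.sum-bijection +-commutativeMonoid (λ x → χ x ^ j)
                                                            (λ x≈ → ^-congˡ j (χ-cong x≈)) (scaling y y≉0) ⟩
        sum (λ i → χ (y F.* F.elem i) ^ j)             ≈⟨ sum-cong-≋ {q} (λ i → trans (^-congˡ j (χ-* y (F.elem i)))
                                                            (^-distrib-* (χ y) (χ (F.elem i)) j)) ⟩
        sum (λ i → χ y ^ j * χ (F.elem i) ^ j)         ≈⟨ *-distribˡ-sum (χ y ^ j) (λ i → χ (F.elem i) ^ j) ⟨
        χ y ^ j * s                                    ∎)))
      where s = sum (λ i → χ (F.elem i) ^ j)

    -- χ(x) + … + χ(x)ᵏ⁻¹.
    ∑powers : F.Carrier → Carrier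
    ∑powers x = powerSum m (χ x)

    -- The units at which χ takes the value 1.
    Kernel : F.Carrier → Set _
    Kernel x = ¬ x F.≈ F.0# × χ x ≈ 1#

    -- The indicator of the units.
    𝟙≉0 : F.Carrier → ℕ
    𝟙≉0 x = 𝟙 (¬? (x F.≟ F.0#))

    -- Adding the missing term χ(x)⁰, for a unit x, completes the geometric sum.
    ∑powers-kernel : ∀ x (d : Dec (Kernel x)) → ∑powers x + ν (𝟙≉0 x) ≈ ν (k ℕ.* 𝟙 d)
    ∑powers-kernel x d with x F.≟ F.0#
    ∑powers-kernel x (yes (x≉0 , _)) | yes x≈0 = contradiction x≈0 x≉0
    ∑powers-kernel x (no _)          | yes x≈0 = trans (+-identityʳ _)
      (trans (powerSum-0 m (χ-0 x≈0)) (sym (ν-cong (ℕ.*-zeroʳ k))))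
    ∑powers-kernel x (yes (_ , χ≈1)) | no x≉0  = trans (+-comm _ _) (trans (+-congʳ (+-identityʳ 1#))
      (trans (powerSum-1 m χ≈1) (sym (ν-cong (ℕ.*-identityʳ k)))))
    ∑powers-kernel x (no ¬ker)       | no x≉0  = trans (+-comm _ _) (trans (+-congʳ (+-identityʳ 1#))
      (trans (fixed⇒0 (λ χ≈1 → ¬ker (x≉0 , χ≈1)) (geometric-fixed m (χᵏ≈1 x≉0))) (sym (ν-cong (ℕ.*-zeroʳ k)))))

    S⊆Kernel : ∀ {x} → Sₖ x → Kernel x
    S⊆Kernel {x} (y , y≉0 , yᵏ≈x) = S≉0 (y , y≉0 , yᵏ≈x) ,
      trans (χ-cong (F.sym yᵏ≈x)) (trans (χ-^ k) (χᵏ≈1 y≉0))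
      where
      χ-^ : ∀ n → χ (y F.^ n) ≈ χ y ^ n
      χ-^ zero    = χ-1
      χ-^ (suc n) = trans (χ-* y (y F.^ n)) (*-congˡ (χ-^ n))

    -- Consequences of deciding membership in the kernel.
    module WithKernel (ker? : ∀ i → Dec (Kernel (F.elem i))) where

      #kernel : ℕ
      #kernel = ∑ℕ (λ i → 𝟙 (ker? i))

      #units≡k*#kernel : #units ≡ k ℕ.* #kernel
      #units≡k*#kernel = ν-injective (begin
        ν #units                                            ≈⟨ ν-∑ {q} (λ i → 𝟙≉0 (F.elem i)) ⟨
        sum (λ i → ν (𝟙≉0 (F.elem i)))                      ≈⟨ +-identityˡ _ ⟨
        0# + sum (λ i → ν (𝟙≉0 (F.elem i)))                 ≈⟨ +-congʳ (trans (∑-comm {q} {m} (λ i s → χ (F.elem i) ^ suc (toℕ s)))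
                                                                 (sum-zero +-commutativeMonoid {m} λ s → ∑χʲ≈0 (s≤s z≤n) (s≤s (Fin.toℕ<n s)))) ⟨
        sum (λ i → ∑powers (F.elem i)) + sum (λ i → ν (𝟙≉0 (F.elem i)))  ≈⟨ ∑-distrib-+ {q} (λ i → ∑powers (F.elem i)) _ ⟨
        sum (λ i → ∑powers (F.elem i) + ν (𝟙≉0 (F.elem i)))      ≈⟨ sum-cong-≋ {q} (λ i → ∑powers-kernel (F.elem i) (ker? i)) ⟩
        sum (λ i → ν (k ℕ.* 𝟙 (ker? i)))                    ≈⟨ ν-∑ {q} (λ i → k ℕ.* 𝟙 (ker? i)) ⟩
        ν (∑ℕ (λ i → k ℕ.* 𝟙 (ker? i)))                     ≈⟨ ν-cong (ℕΣ.*-distribˡ-sum k (λ i → 𝟙 (ker? i))) ⟨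
        ν (k ℕ.* #kernel)                                   ∎)

      𝟙S≤𝟙kernel : ∀ i → 𝟙S (F.elem i) ℕ.≤ 𝟙 (ker? i)
      𝟙S≤𝟙kernel i = 𝟙-mono S⊆Kernel (S? F k (F.elem i)) (ker? i)

      #kernel≤#S : #kernel ℕ.≤ #S
      #kernel≤#S = ℕ.*-cancelˡ-≤ k (ℕ.≤-trans (ℕ.≤-reflexive (≡.sym #units≡k*#kernel)) #units≤k*#S)

      -- The kernel contains S, and S is not smaller than the kernel.
      𝟙S≡𝟙kernel : ∀ i → 𝟙S (F.elem i) ≡ 𝟙 (ker? i)
      𝟙S≡𝟙kernel = ∑-squeeze 𝟙S≤𝟙kernel #kernel≤#S

    #units≡k*#S : #units ≡ k ℕ.* #S
    #units≡k*#S = decidable-stable (#units ℕ.≟ k ℕ.* #S) λ ¬eq → ¬¬-dec-all (Kernel ∘ F.elem) λ ker? →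
      let open WithKernel ker? in
      ¬eq (≡.trans #units≡k*#kernel (≡.cong (k ℕ.*_) (ℕΣ.sum-cong-≗ (≡.sym ∘ 𝟙S≡𝟙kernel))))

    ∑powers-S : ∀ x → ∑powers x + ν (𝟙≉0 x) ≈ ν (k ℕ.* 𝟙S x)
    ∑powers-S x = trans (+-cong (powerSum-cong m (χ-cong x≈)) (ν-cong (𝟙-cong (λ x≉0 e≈0 → x≉0 (F.trans x≈ e≈0)) (λ e≉0 x≈0 → e≉0 (F.trans (F.sym x≈) x≈0))
                       (¬? (x F.≟ F.0#)) (¬? (F.elem (F.index x) F.≟ F.0#)))))
      (trans (at (F.index x)) (ν-cong (≡.cong (k ℕ.*_) (𝟙S-cong (F.sym x≈)))))
      where
      x≈ : x F.≈ F.elem (F.index x)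
      x≈ = F.sym (elem-index x)
      at : ∀ i → ∑powers (F.elem i) + ν (𝟙≉0 (F.elem i)) ≈ ν (k ℕ.* 𝟙S (F.elem i))
      at i = stable _ _ λ ¬eq → ¬¬-dec-all (Kernel ∘ F.elem) λ ker? → ¬eq
        (trans (∑powers-kernel (F.elem i) (ker? i)) (ν-cong (≡.cong (k ℕ.*_) (≡.sym (WithKernel.𝟙S≡𝟙kernel ker? i)))))

    ∑powers-unit : ∀ {x} → ¬ x F.≈ F.0# → ∑powers x + 1# ≈ ν (k ℕ.* 𝟙S x)
    ∑powers-unit {x} x≉0 = trans (+-congˡ (sym (trans (ν-cong (𝟙-yes (¬? (x F.≟ F.0#)) x≉0)) (+-identityʳ 1#)))) (∑powers-S x)

    -- In the application χ^ s is the extension by 0 of the s-th power of χ.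
    module JacobiSums (-1∉Sₖ : ¬ Sₖ (F.- F.1#))
      (χ^ : ℕ → F.Carrier → Carrier) (χ^≈ : ∀ s x → χ^ (suc s) x ≈ χ x ^ suc s) where

      module _ (z : F.Carrier) where
        1-z = F.1# F.- z
        open OffDiagonal m (λ s → χ^ s z) (λ t → χ^ t 1-z) {χ z} {χ 1-z} (λ s → χ^≈ s z) (λ t → χ^≈ t 1-z) public
          hiding (k)

      -- The indicators of z, 1 - z and z / (1 - z) being k-th powers of units, and of
      -- z being 0 or 1.  The quotient is written as 1 / (1 - z) - 1, so that it runs
      -- through the whole field as z does; at z = 1 it takes the value -1.
      α β γ θ : F.Carrier → ℕ
      α z = 𝟙S z
      β z = 𝟙S (F.1# F.- z)
      γ z = 𝟙S (inv (F.1# F.- z) F.- F.1#)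
      θ z = 𝟙 (z F.≟ F.0#) ℕ.+ 𝟙 (z F.≟ F.1#)

      private
        open Solver commutativeSemiring using (solve; _:+_; _:*_; _:=_; con)
        open ℕSolver.+-*-Solver using () renaming
          (solve to solve-ℕ; _:+_ to _:+ℕ_; _:*_ to _:*ℕ_; _:=_ to _:=ℕ_; con to con-ℕ)

        𝟙S-1 : ∀ {x} → x F.≈ F.1# → 𝟙S x ≡ 1
        𝟙S-1 {x} x≈1 = 𝟙-yes (S? F k x) (S-cong (F.sym x≈1) S-1)

        𝟙S-0 : ∀ {x} → x F.≈ F.0# → 𝟙S x ≡ 0
        𝟙S-0 {x} x≈0 = 𝟙-no (S? F k x) λ s → S≉0 s x≈0

        ν-*′ : ∀ m n → ν (m ℕ.* n) ≈ ν m * ν n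
        ν-*′ = Mult.×1-homo-* semiring

      -- For z different from 0 and 1 both sides equal (kα - 1)(kβ - 1) + kα + kβ + 1;
      -- for z = 0 and z = 1 they equal k, which is 2 + k′.
      pointwise : ∀ z → offDiagonal z + ν (k ℕ.* α z ℕ.+ k ℕ.* β z ℕ.+ k ℕ.* γ z) ≈
                        ν ((k ℕ.* α z) ℕ.* (k ℕ.* β z) ℕ.+ (2 ℕ.+ k′ ℕ.* θ z))
      pointwise z = case z F.≟ F.0# of λ where
          (yes z≈0) → at-0 z≈0
          (no  z≉0) → case z F.≟ F.1# of λ where
            (yes z≈1) → at-1 z≉0 z≈1
            (no  z≉1) → generic z≉0 z≉1
        where
        w = inv (F.1# F.- z)
        x-0 : ∀ x → x F.- F.0# F.≈ x
        x-0 x = F.trans (F.+-congˡ (RingProperties.-0#≈0# F.ring)) (F.+-identityʳ x)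
        Claim : Set _
        Claim = offDiagonal z + ν (k ℕ.* α z ℕ.+ k ℕ.* β z ℕ.+ k ℕ.* γ z) ≈
                ν ((k ℕ.* α z) ℕ.* (k ℕ.* β z) ℕ.+ (2 ℕ.+ k′ ℕ.* θ z))
        degenerate : χ z ≈ 0# ⊎ χ (F.1# F.- z) ≈ 0# → k ℕ.* α z ℕ.+ k ℕ.* β z ℕ.+ k ℕ.* γ z ≡
                     (k ℕ.* α z) ℕ.* (k ℕ.* β z) ℕ.+ (2 ℕ.+ k′ ℕ.* θ z) → Claim
        degenerate χ≈0 eq = trans (+-congʳ (offDiagonal-0 z χ≈0)) (trans (+-identityˡ _) (ν-cong eq))
        at-0 : z F.≈ F.0# → Claim
        at-0 z≈0 = degenerate (inj₁ (χ-0 z≈0)) (arithmetic (𝟙S-0 z≈0) (𝟙S-1 1-z≈1)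
            (𝟙S-0 (F.trans (F.+-congʳ (inv-unique (F.trans (F.*-identityʳ _) 1-z≈1))) (F.-‿inverseʳ F.1#)))
            (≡.cong₂ ℕ._+_ (𝟙-yes (z F.≟ F.0#) z≈0) (𝟙-no (z F.≟ F.1#) λ z≈1 → F.1≉0 (F.trans (F.sym z≈1) z≈0))))
          where
          1-z≈1 : F.1# F.- z F.≈ F.1#
          1-z≈1 = F.trans (-‿cong₂ F.refl z≈0) (x-0 F.1#)
          arithmetic : ∀ {a b c t} → a ≡ 0 → b ≡ 1 → c ≡ 0 → t ≡ 1 →
            k ℕ.* a ℕ.+ k ℕ.* b ℕ.+ k ℕ.* c ≡ (k ℕ.* a) ℕ.* (k ℕ.* b) ℕ.+ (2 ℕ.+ k′ ℕ.* t)
          arithmetic ≡.refl ≡.refl ≡.refl ≡.refl = solve-ℕ 1 (λ k′ → let k = con-ℕ 2 :+ℕ k′ in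
            k :*ℕ con-ℕ 0 :+ℕ k :*ℕ con-ℕ 1 :+ℕ k :*ℕ con-ℕ 0 :=ℕ
            (k :*ℕ con-ℕ 0) :*ℕ (k :*ℕ con-ℕ 1) :+ℕ (con-ℕ 2 :+ℕ k′ :*ℕ con-ℕ 1)) ≡.refl k′
        at-1 : ¬ z F.≈ F.0# → z F.≈ F.1# → Claim
        at-1 z≉0 z≈1 = degenerate (inj₂ (χ-0 1-z≈0)) (arithmetic (𝟙S-1 z≈1) (𝟙S-0 1-z≈0)
            (𝟙-no (S? F k (w F.- F.1#)) λ s → -1∉Sₖ
              (S-cong (F.trans (F.+-congʳ (inv-0 1-z≈0)) (F.+-identityˡ _)) s))
            (≡.cong₂ ℕ._+_ (𝟙-no (z F.≟ F.0#) z≉0) (𝟙-yes (z F.≟ F.1#) z≈1)))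
          where
          1-z≈0 : F.1# F.- z F.≈ F.0#
          1-z≈0 = F.trans (-‿cong₂ F.refl z≈1) (F.-‿inverseʳ F.1#)
          arithmetic : ∀ {a b c t} → a ≡ 1 → b ≡ 0 → c ≡ 0 → t ≡ 1 →
            k ℕ.* a ℕ.+ k ℕ.* b ℕ.+ k ℕ.* c ≡ (k ℕ.* a) ℕ.* (k ℕ.* b) ℕ.+ (2 ℕ.+ k′ ℕ.* t)
          arithmetic ≡.refl ≡.refl ≡.refl ≡.refl = solve-ℕ 1 (λ k′ → let k = con-ℕ 2 :+ℕ k′ in
            k :*ℕ con-ℕ 1 :+ℕ k :*ℕ con-ℕ 0 :+ℕ k :*ℕ con-ℕ 0 :=ℕ
            (k :*ℕ con-ℕ 1) :*ℕ (k :*ℕ con-ℕ 0) :+ℕ (con-ℕ 2 :+ℕ k′ :*ℕ con-ℕ 1)) ≡.refl k′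
        generic : ¬ z F.≈ F.0# → ¬ z F.≈ F.1# → Claim
        generic z≉0 z≉1 = begin
          T + ν (k ℕ.* α z ℕ.+ k ℕ.* β z ℕ.+ k ℕ.* γ z)
            ≈⟨ +-congˡ (trans (ν-+ (k ℕ.* α z ℕ.+ k ℕ.* β z) (k ℕ.* γ z)) (+-congʳ (ν-+ (k ℕ.* α z) (k ℕ.* β z)))) ⟩
          T + (ν (k ℕ.* α z) + ν (k ℕ.* β z) + ν (k ℕ.* γ z))
            ≈⟨ +-congˡ (+-cong (+-cong (∑powers-unit z≉0) (∑powers-unit y≉0)) (trans (+-congʳ (powerSum-cong m (sym χ-quotient))) (∑powers-unit g≉0))) ⟨
          T + (a + 1# + (b + 1#) + (d + 1#))
            ≈⟨ solve 4 (λ t a b d → t :+ (a :+ con 1 :+ (b :+ con 1) :+ (d :+ con 1)) :=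
                 (t :+ d) :+ (a :+ b :+ con 1 :+ con 2)) refl T a b d ⟩
          (T + d) + (a + b + 1# + (1# + 1#))
            ≈⟨ +-congʳ (trans (+-congˡ (sym (diagonal-inverse z (χᵏ≈1 y≉0) vw≈1))) (offDiagonal+diagonal z)) ⟩
          a * b + (a + b + 1# + (1# + 1#))
            ≈⟨ solve 2 (λ a b → a :* b :+ (a :+ b :+ con 1 :+ con 2) := (a :+ con 1) :* (b :+ con 1) :+ con 2) refl a b ⟩
          (a + 1#) * (b + 1#) + (1# + 1#)
            ≈⟨ +-cong (*-cong (∑powers-unit z≉0) (∑powers-unit y≉0)) (sym (trans (ν-cong two) (+-congˡ (+-identityʳ 1#)))) ⟩
          ν (k ℕ.* α z) * ν (k ℕ.* β z) + ν (2 ℕ.+ k′ ℕ.* θ z)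
            ≈⟨ +-congʳ (ν-*′ (k ℕ.* α z) (k ℕ.* β z)) ⟨
          ν ((k ℕ.* α z) ℕ.* (k ℕ.* β z)) + ν (2 ℕ.+ k′ ℕ.* θ z)
            ≈⟨ ν-+ ((k ℕ.* α z) ℕ.* (k ℕ.* β z)) _ ⟨
          ν ((k ℕ.* α z) ℕ.* (k ℕ.* β z) ℕ.+ (2 ℕ.+ k′ ℕ.* θ z)) ∎
          where
          y = F.1# F.- z
          g = w F.- F.1#
          T = offDiagonal z
          a = ∑powers z
          b = ∑powers y
          d = powerSum m (χ z * χ w)
          two : 2 ℕ.+ k′ ℕ.* θ z ≡ 2
          two = ≡.cong (2 ℕ.+_) (≡.trans
            (≡.cong (k′ ℕ.*_) (≡.cong₂ ℕ._+_ (𝟙-no (z F.≟ F.0#) z≉0) (𝟙-no (z F.≟ F.1#) z≉1))) (ℕ.*-zeroʳ k′))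
          z≈1-y : F.1# F.- y F.≈ z
          z≈1-y = y-[y-x] F.1# z
          y≉0 : ¬ y F.≈ F.0#
          y≉0 y≈0 = z≉1 (F.trans (F.sym z≈1-y) (F.trans (-‿cong₂ F.refl y≈0) (x-0 F.1#)))
          zw≈g : z F.* w F.≈ g
          zw≈g = F.trans (F.*-congʳ (F.sym z≈1-y)) (F.trans (RingProperties.[y-z]x≈yx-zx F.ring w F.1# y)
            (-‿cong₂ (F.*-identityˡ w) (inv-inverse y≉0)))
          g≉0 : ¬ g F.≈ F.0#
          g≉0 g≈0 = F.*-nonZero z≉0 (inv≉0 y≉0) (F.trans zw≈g g≈0)
          χ-quotient : χ g ≈ χ z * χ w
          χ-quotient = trans (χ-cong (F.sym zw≈g)) (χ-* z w)
          vw≈1 : χ y * χ w ≈ 1#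
          vw≈1 = trans (sym (χ-* y w)) (trans (χ-cong (inv-inverse y≉0)) χ-1)

      ∑β≡#S : ∑F β ≡ #S
      ∑β≡#S = ≡.sym (∑F-bijection 𝟙S 𝟙S-cong (reflection F.1#))

      ∑γ≡#S : ∑F γ ≡ #S
      ∑γ≡#S = ≡.sym (≡.trans (∑F-bijection 𝟙S 𝟙S-cong (translation (F.- F.1#)))
        (≡.trans (∑F-bijection (λ x → 𝟙S (x F.- F.1#)) (λ x≈ → 𝟙S-cong (F.+-congʳ x≈)) inversion)
                 (∑F-bijection (λ x → 𝟙S (inv x F.- F.1#)) (λ x≈ → 𝟙S-cong (F.+-congʳ (inv-cong x≈))) (reflection F.1#))))

      ∑θ≡2 : ∑F θ ≡ 2
      ∑θ≡2 = ≡.trans (ℕΣ.∑-distrib-+ (λ i → 𝟙 (F.elem i F.≟ F.0#)) _) (≡.cong₂ ℕ._+_ (∑F-point F.0#) (∑F-point F.1#))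

      ∑offDiagonal : sum (λ i → offDiagonal (F.elem i)) + ν (k ℕ.* #S ℕ.+ k ℕ.* #S ℕ.+ k ℕ.* #S) ≈
                     ν (k ℕ.* k ℕ.* #consecutive ℕ.+ (q ℕ.* 2 ℕ.+ k′ ℕ.* 2))
      ∑offDiagonal = begin
        sum (λ i → offDiagonal (F.elem i)) + ν (k ℕ.* #S ℕ.+ k ℕ.* #S ℕ.+ k ℕ.* #S)
          ≈⟨ +-congˡ (trans (ν-∑ {q} (λ i → k ℕ.* α (F.elem i) ℕ.+ k ℕ.* β (F.elem i) ℕ.+ k ℕ.* γ (F.elem i))) (ν-cong left)) ⟨
        sum (λ i → offDiagonal (F.elem i)) + sum (λ i → ν (k ℕ.* α (F.elem i) ℕ.+ k ℕ.* β (F.elem i) ℕ.+ k ℕ.* γ (F.elem i)))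
          ≈⟨ ∑-distrib-+ {q} (λ i → offDiagonal (F.elem i)) _ ⟨
        sum (λ i → offDiagonal (F.elem i) + ν (k ℕ.* α (F.elem i) ℕ.+ k ℕ.* β (F.elem i) ℕ.+ k ℕ.* γ (F.elem i)))
          ≈⟨ sum-cong-≋ {q} (λ i → pointwise (F.elem i)) ⟩
        sum (λ i → ν ((k ℕ.* α (F.elem i)) ℕ.* (k ℕ.* β (F.elem i)) ℕ.+ (2 ℕ.+ k′ ℕ.* θ (F.elem i))))
          ≈⟨ trans (ν-∑ {q} (λ i → (k ℕ.* α (F.elem i)) ℕ.* (k ℕ.* β (F.elem i)) ℕ.+ (2 ℕ.+ k′ ℕ.* θ (F.elem i)))) (ν-cong right) ⟩
        ν (k ℕ.* k ℕ.* #consecutive ℕ.+ (q ℕ.* 2 ℕ.+ k′ ℕ.* 2)) ∎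
        where
        scale : ∀ c (f : F.Carrier → ℕ) → ∑F (λ z → c ℕ.* f z) ≡ c ℕ.* ∑F f
        scale c f = ≡.sym (ℕΣ.*-distribˡ-sum c (λ i → f (F.elem i)))
        plus : ∀ (f g : F.Carrier → ℕ) → ∑F (λ z → f z ℕ.+ g z) ≡ ∑F f ℕ.+ ∑F g
        plus f g = ℕΣ.∑-distrib-+ (λ i → f (F.elem i)) (λ i → g (F.elem i))
        left : ∑F (λ z → k ℕ.* α z ℕ.+ k ℕ.* β z ℕ.+ k ℕ.* γ z) ≡ k ℕ.* #S ℕ.+ k ℕ.* #S ℕ.+ k ℕ.* #S
        left = ≡.trans (plus (λ z → k ℕ.* α z ℕ.+ k ℕ.* β z) (λ z → k ℕ.* γ z))
          (≡.cong₂ ℕ._+_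
            (≡.trans (plus (λ z → k ℕ.* α z) (λ z → k ℕ.* β z))
              (≡.cong₂ ℕ._+_ (scale k α) (≡.trans (scale k β) (≡.cong (k ℕ.*_) ∑β≡#S))))
            (≡.trans (scale k γ) (≡.cong (k ℕ.*_) ∑γ≡#S)))
        right : ∑F (λ z → (k ℕ.* α z) ℕ.* (k ℕ.* β z) ℕ.+ (2 ℕ.+ k′ ℕ.* θ z)) ≡
                k ℕ.* k ℕ.* #consecutive ℕ.+ (q ℕ.* 2 ℕ.+ k′ ℕ.* 2)
        right = ≡.trans (plus (λ z → (k ℕ.* α z) ℕ.* (k ℕ.* β z)) (λ z → 2 ℕ.+ k′ ℕ.* θ z))
          (≡.cong₂ ℕ._+_
            (≡.trans (ℕΣ.sum-cong-≗ {q} λ i → ℕ.[m*n]*[o*p]≡[m*o]*[n*p] k (α (F.elem i)) k (β (F.elem i)))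
                     (scale (k ℕ.* k) (λ z → α z ℕ.* β z)))
            (≡.trans (plus (λ _ → 2) (λ z → k′ ℕ.* θ z))
              (≡.cong₂ ℕ._+_ (∑-const q 2) (≡.trans (scale k′ θ) (≡.cong (k′ ℕ.*_) ∑θ≡2)))))

      -- The Jacobi sum of the s-th and the t-th power of χ.
      jacobi : ℕ → ℕ → Carrier
      jacobi s t = sum (λ i → χ^ s (F.elem i) * χ^ t (F.1# F.- F.elem i))

      -- Stated for any 𝐽 that agrees with jacobi up to the equality of the ring.
      ∑jacobi : (𝐽 : ℕ → ℕ → Carrier) → (∀ s t → 𝐽 s t ≈ jacobi s t) →
        sumₗ (λ (s , t) → 𝐽 s t) (offDiagonalPairs k) + ν (k ℕ.* #S ℕ.+ k ℕ.* #S ℕ.+ k ℕ.* #S) ≈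
        ν (k ℕ.* k ℕ.* #consecutive ℕ.+ (q ℕ.* 2 ℕ.+ k′ ℕ.* 2))
      ∑jacobi 𝐽 𝐽≈ = trans (+-congʳ (trans
        (sumₗ-cong (λ (s , t) → 𝐽≈ s t) (offDiagonalPairs k))
        (sumₗ-sum {n = q} (λ (s , t) i → χ^ s (F.elem i) * χ^ t (F.1# F.- F.elem i)) (offDiagonalPairs k)))) ∑offDiagonal

-- Paley digraphs and their characters.

open import Data.Integer.Base using () renaming (_+_ to _+ℤ_; _-_ to _-ℤ_)
open import Data.Nat.Base using (NonTrivial; nonTrivial⇒nonZero; _+_; _*_; _^_; _∸_)
open import Data.Nat.Properties using (m^n≢0)

/-*-/1 : ∀ a b n d .{{_ : ℕ.NonZero d}} → a * b ≡ n * d → (+ a / d) ℚ.* (+ b / 1) ≡ + n / 1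
/-*-/1 a b n (suc d) ab≡nd = ℚ.toℚᵘ-injective (ℚᵘ.≃-trans (ℚ.toℚᵘ-homo-* (+ a / suc d) (+ b / 1))
  (ℚᵘ.≃-trans (ℚᵘ.*-cong {ℚ.toℚᵘ (+ a / suc d)} {ℚᵘ.mkℚᵘ (+ a) d} {ℚ.toℚᵘ (+ b / 1)} {ℚᵘ.mkℚᵘ (+ b) 0}
      (ℚ.toℚᵘ-fromℚᵘ (ℚᵘ.mkℚᵘ (+ a) d)) (ℚ.toℚᵘ-fromℚᵘ (ℚᵘ.mkℚᵘ (+ b) 0)))
  (ℚᵘ.≃-trans (ℚᵘ.*≡* cross) (ℚᵘ.≃-sym (ℚ.toℚᵘ-fromℚᵘ (ℚᵘ.mkℚᵘ (+ n) 0))))))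
  where
  open ≡.≡-Reasoning
  cross : (+ a ℤ.* + b) ℤ.* + 1 ≡ + n ℤ.* + (suc d * 1)
  cross = begin
    (+ a ℤ.* + b) ℤ.* + 1  ≡⟨ ℤ.*-identityʳ (+ a ℤ.* + b) ⟩
    + a ℤ.* + b            ≡⟨ ℤ.pos-* a b ⟨
    + (a * b)              ≡⟨ ≡.cong +_ ab≡nd ⟩
    + (n * suc d)          ≡⟨ ℤ.pos-* n (suc d) ⟩
    + n ℤ.* + suc d        ≡⟨ ≡.cong (λ t → + n ℤ.* + t) (ℕ.*-identityʳ (suc d)) ⟨
    + n ℤ.* + (suc d * 1)  ∎

fromℤ-+ : ∀ i j → fromℤ (i +ℤ j) ≈ℂ fromℤ i +ℂ fromℤ j
fromℤ-+ i j = ≈ℂ-trans {fromℤ (i +ℤ j)} {ι (i / 1 ℚ.+ j / 1)} {fromℤ i +ℂ fromℤ j}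
  (ι-cong (/1-homo-+ i j)) (ι-homo-+ (i / 1) (j / 1))

open RingSums ℂ-commutativeRing using (ν)

ν⇒fromℤ : ∀ {x y a b} → x ≡ y → y +ℂ ν a ≈ℂ ν b → x +ℂ fromℤ (+ a) ≈ℂ fromℤ (+ b)
ν⇒fromℤ {x} {y} {a} {b} ≡.refl eq = begin
  x +ℂ fromℤ (+ a)  ≈⟨ ℂ-Ring.+-congˡ {x} {ν a} {fromℤ (+ a)} (×1≈ι a) ⟨
  x +ℂ ν a          ≈⟨ eq ⟩
  ν b               ≈⟨ ×1≈ι b ⟩
  fromℤ (+ b)       ∎
  where open SetoidReasoning ℂ-Ring.setoid

module _ {c ℓ q} (F : FiniteField c ℓ q) where
  open FiniteField F using (0#; 1#; elem) renaming (_≈_ to _≈F_; _≟_ to _≟F_; _*_ to _*F_; _-_ to _-F_)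
  private module F = FiniteField F
  open MonoidHomomorphism using (⟦_⟧; ⟦⟧-cong; homo; ε-homo)
  open Field F
  open ListSum ℂ-Ring.+-commutativeMonoid using (sumₗ)

  -- Comparing the sums of Jacobi sums while k is still a variable keeps the filtered
  -- list of exponents from being evaluated.
  𝐑-list : ∀ k χ → 𝐑 F k χ ≡ sumₗ (λ (s , t) → J F (_^χ_ F χ s) (_^χ_ F χ t)) (offDiagonalPairs k)
  𝐑-list k χ = ≡.refl

  Paley-asymmetric : ∀ {k} → ¬ S F k (F.- 1#) → let open Digraph (Paley F k) in ∀ {u v} → u ⟶ v → ¬ v ⟶ u
  Paley-asymmetric {k} -1∉ {u} {v} uv vu = -1∉ (S-cancel uv (S-cong (F.sym eq) vu))
    where
    open Powers k
    open RingProperties F.ring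
    eq : (elem v -F elem u) *F (F.- 1#) ≈F elem u -F elem v
    eq = F.trans (F.*-comm _ _) (F.trans (-1*x≈-x _) (⁻¹-anti-homo‿- (elem v) (elem u)))

  -- A term #triples-at for each of the q possible first vertices.
  𝒦₃-Paley : ∀ {k} → ¬ S F k (F.- 1#) → 𝒦 3 (Paley F k) ≡ q * (Powers.#S k * Powers.#consecutive k)
  𝒦₃-Paley {k} -1∉S = ≡.trans (𝒦₃≡#triples (Paley F k) (λ {u} {v} → Paley-asymmetric {k} -1∉S {u} {v}))
    (≡.trans (ℕΣ.sum-cong-≗ {q} (λ a → Powers.#triples-at k (elem a))) (∑-const q _))

  -- The extension of a character by 0 is multiplicative on the whole field.
  module Extension (χ : Character F) where

    extend-0 : ∀ {x} → x ≈F 0# → extend F χ x ≈ℂ ι 0ℚ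
    extend-0 {x} x≈0 with x ≟F 0#
    ... | yes _   = ℂ-Ring.refl {ι 0ℚ}
    ... | no  x≉0 = contradiction x≈0 x≉0

    extend-unit : ∀ {x} (x≉0 : ¬ x ≈F 0#) → extend F χ x ≈ℂ ⟦ χ ⟧ (x , x≉0)
    extend-unit {x} x≉0 with x ≟F 0#
    ... | yes x≈0  = contradiction x≈0 x≉0
    ... | no  x≉0′ = ⟦⟧-cong χ {x , x≉0′} {x , x≉0} F.refl

    extend-cong : ∀ {x y} → x ≈F y → extend F χ x ≈ℂ extend F χ y
    extend-cong {x} {y} x≈y with x ≟F 0# | y ≟F 0#
    ... | yes _   | yes _   = ℂ-Ring.refl {ι 0ℚ}
    ... | yes x≈0 | no  y≉0 = contradiction (F.trans (F.sym x≈y) x≈0) y≉0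
    ... | no  x≉0 | yes y≈0 = contradiction (F.trans x≈y y≈0) x≉0
    ... | no  x≉0 | no  y≉0 = ⟦⟧-cong χ {x , x≉0} {y , y≉0} x≈y

    extend-1 : extend F χ 1# ≈ℂ ι 1ℚ
    extend-1 = ≈ℂ-trans {extend F χ 1#} {⟦ χ ⟧ (1# , F.1≉0)} {ι 1ℚ} (extend-unit F.1≉0) (ε-homo χ)

    extend-* : ∀ x y → extend F χ (x *F y) ≈ℂ extend F χ x *ℂ extend F χ y
    extend-* x y = go (x ≟F 0#) (y ≟F 0#)
      where
      open SetoidReasoning ℂ-Ring.setoid
      go : Dec (x ≈F 0#) → Dec (y ≈F 0#) → extend F χ (x *F y) ≈ℂ extend F χ x *ℂ extend F χ y
      go (yes x≈0) _ = begin
        extend F χ (x *F y)            ≈⟨ extend-0 (F.trans (F.*-congʳ x≈0) (F.zeroˡ y)) ⟩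
        ι 0ℚ                           ≈⟨ ℂ-Ring.zeroˡ (extend F χ y) ⟨
        ι 0ℚ *ℂ extend F χ y           ≈⟨ ℂ-Ring.*-congʳ {extend F χ y} {extend F χ x} {ι 0ℚ} (extend-0 x≈0) ⟨
        extend F χ x *ℂ extend F χ y   ∎
      go (no _) (yes y≈0) = begin
        extend F χ (x *F y)            ≈⟨ extend-0 (F.trans (F.*-congˡ y≈0) (F.zeroʳ x)) ⟩
        ι 0ℚ                           ≈⟨ ℂ-Ring.zeroʳ (extend F χ x) ⟨
        extend F χ x *ℂ ι 0ℚ           ≈⟨ ℂ-Ring.*-congˡ {extend F χ x} {extend F χ y} {ι 0ℚ} (extend-0 y≈0) ⟨
        extend F χ x *ℂ extend F χ y   ∎
      go (no x≉0) (no y≉0) = begin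
        extend F χ (x *F y)                       ≈⟨ extend-unit (F.*-nonZero x≉0 y≉0) ⟩
        ⟦ χ ⟧ (x *F y , F.*-nonZero x≉0 y≉0)      ≈⟨ homo χ (x , x≉0) (y , y≉0) ⟩
        ⟦ χ ⟧ (x , x≉0) *ℂ ⟦ χ ⟧ (y , y≉0)        ≈⟨ ℂ-Ring.*-cong {extend F χ x} {⟦ χ ⟧ (x , x≉0)} {extend F χ y} {⟦ χ ⟧ (y , y≉0)}
                                                       (extend-unit x≉0) (extend-unit y≉0) ⟨
        extend F χ x *ℂ extend F χ y              ∎

    extend-^χ : ∀ s x → extend F (_^χ_ F χ (suc s)) x ≈ℂ extend F χ x ℂ-Exp.^ suc s
    extend-^χ s x with x ≟F 0#
    ... | yes _   = ℂ-Ring.sym {ι 0ℚ *ℂ ι 0ℚ ℂ-Exp.^ s} {ι 0ℚ} (ℂ-Ring.zeroˡ (ι 0ℚ ℂ-Exp.^ s))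
    ... | no  x≉0 = ℂ-Ring.refl {⟦ χ ⟧ (x , x≉0) ℂ-Exp.^ suc s}

    extend-order : ∀ k → HasOrder F χ k → ∀ {x} → ¬ x ≈F 0# → extend F χ x ℂ-Exp.^ k ≈ℂ ι 1ℚ
    extend-order k (_ , trivial , _) {x} x≉0 = ≈ℂ-trans {extend F χ x ℂ-Exp.^ k} {⟦ χ ⟧ (x , x≉0) ℂ-Exp.^ k} {ι 1ℚ}
      (ℂ-Exp.^-congˡ k {extend F χ x} {⟦ χ ⟧ (x , x≉0)} (extend-unit x≉0)) (trivial (x , x≉0))

    extend-nontrivial : ∀ k → HasOrder F χ k → ∀ j → 1 ℕ.≤ j → j ℕ.< k →
      ¬ (∀ x → ¬ x ≈F 0# → extend F χ x ℂ-Exp.^ j ≈ℂ ι 1ℚ)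
    extend-nontrivial k (_ , _ , nontrivial) j 1≤j j<k trivial = nontrivial j 1≤j j<k λ (x , x≉0) →
      ≈ℂ-trans {⟦ χ ⟧ (x , x≉0) ℂ-Exp.^ j} {extend F χ x ℂ-Exp.^ j} {ι 1ℚ}
        (ℂ-Exp.^-congˡ j {⟦ χ ⟧ (x , x≉0)} {extend F χ x}
          (ℂ-Ring.sym {extend F χ x} {⟦ χ ⟧ (x , x≉0)} (extend-unit x≉0)))
        (trivial x x≉0)

  -- A character of order k = k′ + 2.
  module OfOrder (k′ : ℕ) (χ : Character F) (order : HasOrder F χ (suc (suc k′))) where
    open Extension χ
    open CharacterSums F ℂ-commutativeRing k′ using (k) public
    open CharacterSums.WithCharacter F ℂ-commutativeRing k′ ≈ℂ-stable *ℂ-cancel-0 ×1-injective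
      (extend F χ) extend-cong extend-0 extend-1 extend-*
      (extend-order k order) (extend-nontrivial k order) public
    open Powers k public using (#S; #consecutive; 𝟙S; S-1; -1∉S)

    q≡k*#S+1 : q ≡ k * #S + 1
    q≡k*#S+1 = ≡.trans (≡.sym #units+1≡q) (≡.cong (_+ 1) #units≡k*#S)

    #S≢0 : #S ≢ 0
    #S≢0 eq = ℕ.1+n≢0 (≡.trans (≡.sym (𝟙-yes (S? F k (elem (F.index 1#))) (Powers.S-cong k (F.sym (elem-index 1#)) S-1)))
      (ℕ.n≤0⇒n≡0 (≡.subst (𝟙S (elem (F.index 1#)) ℕ.≤_) eq (term≤∑ (λ i → 𝟙S (elem i)) (F.index 1#)))))

    -- q - (k + 1) = k (#S - 1) is divisible by 2k.
    #S-odd : q ≡ k + 1 [mod 2 * k ] → ∃[ j ] #S ≡ suc (2 * j)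
    #S-odd q≡ = go #S ≡.refl
      where
      go : ∀ s → #S ≡ s → ∃[ j ] #S ≡ suc (2 * j)
      go zero    eq = contradiction eq #S≢0
      go (suc s) eq with *-cancelˡ-∣ k (≡.subst₂ _∣_ (ℕ.*-comm 2 k) difference q≡)
        where
        open ≡.≡-Reasoning
        q≡ks+k+1 : q ≡ k * s + (k + 1)
        q≡ks+k+1 = ≡.trans q≡k*#S+1 (≡.trans (≡.cong (λ t → k * t + 1) eq)
          (≡.trans (≡.cong (_+ 1) (≡.trans (ℕ.*-suc k s) (ℕ.+-comm k (k * s)))) (ℕ.+-assoc (k * s) k 1)))
        difference : ℤ.∣ + q ℤ.- + (k + 1) ∣ ≡ k * s
        difference = begin
          ℤ.∣ + q ℤ.- + (k + 1) ∣                ≡⟨ ≡.cong ℤ.∣_∣ (ℤ.m-n≡m⊖n q (k + 1)) ⟩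
          ℤ.∣ q ℤ.⊖ (k + 1) ∣                    ≡⟨ ≡.cong (λ t → ℤ.∣ t ℤ.⊖ (k + 1) ∣) q≡ks+k+1 ⟩
          ℤ.∣ (k * s + (k + 1)) ℤ.⊖ (k + 1) ∣    ≡⟨ ≡.cong ℤ.∣_∣ (ℤ.⊖-≥ (ℕ.m≤n+m (k + 1) (k * s))) ⟩
          (k * s + (k + 1)) ∸ (k + 1)            ≡⟨ ℕ.m+n∸n≡m (k * s) (k + 1) ⟩
          k * s                                  ∎
      ... | divides j s≡ = j , ≡.trans eq (≡.cong suc (≡.trans s≡ (ℕ.*-comm j 2)))

    -1∉Sₖ : 2 ∣ k → q ≡ k + 1 [mod 2 * k ] → ¬ S F k (F.- 1#)
    -1∉Sₖ (divides h k≡) q≡ = let j , #S≡ = #S-odd q≡ in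
      -1∉S {#S} {j} {h * #S} #units≡k*#S #S≡ (≡.trans q≡k*#S+1 (≡.trans (ℕ.+-comm _ 1)
        (≡.cong suc (≡.trans (≡.cong (_* #S) (≡.trans k≡ (ℕ.*-comm h 2))) (ℕ.*-assoc 2 h #S)))))

    module _ (-1∉ : ¬ S F k (F.- 1#)) where
      open JacobiSums -1∉ (λ s → extend F (_^χ_ F χ s)) extend-^χ using (jacobi; ∑jacobi)

      Jₛₜ : ℕ → ℕ → ℂ
      Jₛₜ s t = J F (_^χ_ F χ s) (_^χ_ F χ t)

      -- Both sides unfold to the same sum over the field.
      Jₛₜ≡jacobi : ∀ s t → Jₛₜ s t ≡ jacobi s t
      Jₛₜ≡jacobi s t = ≡.refl

      ∑J : sumₗ (λ (s , t) → Jₛₜ s t) (offDiagonalPairs k)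
           +ℂ ν (k * #S + k * #S + k * #S) ≈ℂ ν (k * k * #consecutive + (q * 2 + k′ * 2))
      ∑J = ∑jacobi Jₛₜ (λ s t → ℂ-Ring.reflexive (Jₛₜ≡jacobi s t))

      jacobiSum-count :
        𝐑 F k χ +ℂ fromℤ (+ (k * #S + k * #S + k * #S)) ≈ℂ fromℤ (+ (k * k * #consecutive + (q * 2 + k′ * 2)))
      jacobiSum-count = ν⇒fromℤ {𝐑 F k χ} {_} {k * #S + k * #S + k * #S} {k * k * #consecutive + (q * 2 + k′ * 2)}
        (𝐑-list k χ) ∑J

-- The final computation, with s for the order of S, M for #consecutive, N for the
-- number of tournaments and x for the sum of Jacobi sums.
final-arithmetic : ∀ k′ (let k = suc (suc k′)) q s M N (x : ℂ) →
  q ≡ k * s + 1 → N ≡ q * (s * M) →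
  x +ℂ fromℤ (+ (k * s + k * s + k * s)) ≈ℂ fromℤ (+ (k * k * M + (q * 2 + k′ * 2))) →
  fromℤ (+ N) ≈ℂ ι (+ (q * (q ∸ 1)) / k ^ 3) *ℂ (x +ℂ fromℤ (+ q -ℤ + (2 * k) +ℤ + 1))
final-arithmetic k′ q s M N x q≡ N≡ x+3P≈B = begin
  fromℤ (+ N)                 ≈⟨ ι-cong (/-*-/1 (q * (q ∸ 1)) A N (k ^ 3) count) ⟨
  ι (p ℚ.* (+ A / 1))         ≈⟨ ι-homo-* p (+ A / 1) ⟩
  ι p *ℂ fromℤ (+ A)          ≈⟨ *ℂ-cong {ι p} {ι p} {x +ℂ fromℤ c} {fromℤ (+ A)} (ℂ-Ring.refl {ι p}) x+c≈A ⟨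
  ι p *ℂ (x +ℂ fromℤ c)       ∎
  where
  open SetoidReasoning ℂ-Ring.setoid
  k P A B : ℕ
  k = suc (suc k′)
  P = k * s
  A = k * k * M
  B = A + (q * 2 + k′ * 2)
  p : ℚ
  p = + (q * (q ∸ 1)) / k ^ 3
  c : ℤ
  c = + q -ℤ + (2 * k) +ℤ + 1

  count : q * (q ∸ 1) * A ≡ N * k ^ 3
  count = ≡.trans (≡.cong (λ t → q * t * A) (≡.trans (≡.cong (_∸ 1) q≡) (ℕ.m+n∸n≡m P 1)))
    (≡.trans (solve 4 (λ q k s M → q :* (k :* s) :* (k :* k :* M) := q :* (s :* M) :* (k :* (k :* (k :* con 1))))
      ≡.refl q k s M) (≡.cong (_* k ^ 3) (≡.sym N≡)))
    where open ℕSolver.+-*-Solver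

  total : B + (q + 1) ≡ A + (P + P + P) + 2 * k
  total = ≡.trans (≡.cong (λ q → A + (q * 2 + k′ * 2) + (q + 1)) q≡)
    (solve 3 (λ a p k′ → a :+ ((p :+ con 1) :* con 2 :+ k′ :* con 2) :+ ((p :+ con 1) :+ con 1) :=
                         a :+ (p :+ p :+ p) :+ con 2 :* (con 2 :+ k′)) ≡.refl A P k′)
    where open ℕSolver.+-*-Solver

  c-shift : + B +ℤ c ≡ + (A + (P + P + P))
  c-shift = ≡.trans
    (solve 4 (λ b q k o → b :+ (q :- k :+ o) := b :+ (q :+ o) :- k) ≡.refl (+ B) (+ q) (+ (2 * k)) (+ 1))
    (≡.trans (≡.cong (λ t → + t -ℤ + (2 * k)) total)
      (solve 2 (λ x y → x :+ y :- y := x) ≡.refl (+ (A + (P + P + P))) (+ (2 * k))))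
    where open ℤSolver.+-*-Solver

  -- Both sides are increased by 3 k s, so that the hypothesis on x applies.
  x+c≈A : x +ℂ fromℤ c ≈ℂ fromℤ (+ A)
  x+c≈A = RingProperties.+-cancelʳ ℂ-Ring.ring (fromℤ (+ (P + P + P))) (x +ℂ fromℤ c) (fromℤ (+ A)) (begin
    (x +ℂ fromℤ c) +ℂ fromℤ (+ (P + P + P)) ≈⟨ xy∙z≈xz∙y x (fromℤ c) (fromℤ (+ (P + P + P))) ⟩
    (x +ℂ fromℤ (+ (P + P + P))) +ℂ fromℤ c ≈⟨ ℂ-Ring.+-congʳ {fromℤ c} {x +ℂ fromℤ (+ (P + P + P))} {fromℤ (+ B)} x+3P≈B ⟩
    fromℤ (+ B) +ℂ fromℤ c                  ≈⟨ fromℤ-+ (+ B) c ⟨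
    fromℤ (+ B +ℤ c)                        ≡⟨ ≡.cong fromℤ c-shift ⟩
    fromℤ (+ (A + (P + P + P)))             ≈⟨ fromℤ-+ (+ A) (+ (P + P + P)) ⟩
    fromℤ (+ A) +ℂ fromℤ (+ (P + P + P))    ∎)
    where open CommutativeSemigroupProperties ℂ-Ring.+-commutativeSemigroup using (xy∙z≈xz∙y)

theorem2p6 : ∀ {c ℓ} (k : ℕ) .{{k≥2 : NonTrivial k}} → 2 ∣ k →
    (q : ℕ) → IsPrimePower q → q ≡ k + 1 [mod 2 * k ] →
    (F : FiniteField c ℓ q) (χₖ : Character F) → HasOrder F χₖ k →
    fromℤ (+ 𝒦 3 (Paley F k)) ≈ℂ
    ι (_/_ (+ (q * (q ∸ 1))) (k ^ 3) {{m^n≢0 k 3 {{nonTrivial⇒nonZero k}}}})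
    *ℂ (𝐑 F k χₖ +ℂ fromℤ (+ q -ℤ + (2 * k) +ℤ + 1))
theorem2p6 k@(suc (suc k′)) 2∣k q _ q≡ F χ order =
  final-arithmetic k′ q #S #consecutive (𝒦 3 (Paley F k)) (𝐑 F k χ)
    q≡k*#S+1 (𝒦₃-Paley F {k} -1∉) (jacobiSum-count -1∉)
  where
  open OfOrder F k′ χ order hiding (k)
  -1∉ : ¬ S F k (FiniteField.-_ F (FiniteField.1# F))
  -1∉ = -1∉Sₖ 2∣k q≡
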